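{- Let $X$ be a finite multigraph with $\chi(X)\neq 0$, let $\ell$ be an odd prime, let $S$ be the image of a section $\gamma:E_X\to E_X^+$ of the quotient map $\pi:E_X^+\to E_X$, and let $\alpha:S\to\mathbb{Z}_\ell$ be a function such that the derived multigraphs $X(\mathbb{Z}/\ell^n\mathbb{Z},S,\alpha_{/n})$ are connected for all $n\geq 0$. Then $\lambda_\ell(X,\alpha)$ is odd.
   Context: A finite multigraph $X$ consists of a finite set of vertices $V_X=\{v_1,\dots,v_u\}$, a finite set of directed edges $E_X^+$, an incidence function $i:E_X^+\to V_X\times V_X$, $i(e)=(o(e),t(e))$ (origin and target), and an inversion function $\iota:E_X^+\to E_X^+$, $\iota(e)=\bar e$, such that $\iota^2=\mathrm{id}$, $\iota(e)\ne e$ and $i(\bar e)=(t(e),o(e))$ for all $e$. Loops and multiple edges are allowed. The set of undirected edges is $E_X=E_X^+/\iota$, $\pi:E_X^+\to E_X$ is the quotient map, and $\chi(X)=|V_X|-|E_X|$. Derived multigraph: let $G$ be a finite abelian group (written additively) and $\beta:S\to G$ a function, extended to $E_X^+$ by $\beta(\bar s)=-\beta(s)$. The multigraph $X(G,S,\beta)$ has vertex set $V_X\times G$ and directed edge set $E_X^+\times G$; the directed edge $(e,\sigma)$ goes from $(o(e),\sigma)$ to $(t(e),\sigma+\beta(e))$, and $\overline{(e,\sigma)}=(\bar e,\sigma+\beta(e))$. For $\alpha:S\to\mathbb{Z}_\ell$, $\alpha_{/n}$ is its reduction modulo $\ell^n$. Characteristic series: for $b\in\mathbb{Z}_\ell$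 put $\binom{b}{n}=\frac{b(b-1)\cdots(b-n+1)}{n!}\in\mathbb{Z}_\ell$ and $(1+T)^b=\sum_{n\ge0}\binom{b}{n}T^n\in\mathbb{Z}_\ell[[T]]$. Let $D$ be the $u\times u$ diagonal matrix whose $i$-th diagonal entry is the valency $\#\{e\in E_X^+: o(e)=v_i\}$. Let $M(1+T)$ be the $u\times u$ matrix over $\mathbb{Z}_\ell[[T]]$ $$M(1+T)=D-\Big(\sum_{s\in S,\ i(s)=(v_i,v_j)}(1+T)^{\alpha(s)}+\sum_{s\in S,\ i(s)=(v_j,v_i)}(1+T)^{ -\alpha(s)}\Big)_{i,j}$$ and $f(T)=\det M(1+T)$. Under the stated hypotheses $f(T)\ne0$, and its constant term is always $0$. By the Weierstrass preparation theorem write $f(T)=\ell^{\mu}g(T)u(T)$ with $\mu\in\mathbb{Z}_{\ge0}$, $g(T)$ a distinguished polynomial (monic with all non-leading coefficients divisible by $\ell$) and $u(T)\in\mathbb{Z}_\ell[[T]]^\times$. Then $\mu_\ell(X,\alpha):=\mu$ and $\lambda_\ell(X,\alpha):=\deg g(T)-1$ (note the shift by $-1$). -}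

module Defs where

open import Algebra.Bundles using (Group; RawRing)
import Algebra.Properties.Group as GroupProperties
import Algebra.Definitions.RawMagma as RawMagmaDefs
import Algebra.Definitions.RawMonoid as RawMonoidDefs
open import Algebra.Structures using (IsAbelianGroup)
open import Data.Fin.Base using (Fin; zero; suc; toℕ; fromℕ<; punchIn)
import Data.Fin.Properties as Fin
open import Data.Integer.Base as ℤ using (ℤ; +_; 0ℤ; 1ℤ; _%ℕ_; _/ℕ_)
import Data.Integer.DivMod as ℤ
open import Data.Integer.Divisibility.Signed as ℤ using (_∣_; divides)
import Data.Integer.Properties as ℤ
open import Data.Integer.Tactic.RingSolver using (solve-∀)
open import Data.Irrelevant using ([_])
open import Data.List.Base using (length; filter; deduplicate; allFin)
open import Data.Nat.Base as ℕ using (ℕ; zero; suc; NonZero; _∸_; _^_; _!)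
open import Data.Nat.Combinatorics using (_C_; nCk+nC[k+1]≡[n+1]C[k+1]; k>n⇒nCk≡0)
import Data.Nat.Divisibility as ℕ
open import Data.Nat.DivMod using (_%_; _mod_; %-distribˡ-+; m%n%n≡m%n; m%n<n; m<n⇒m%n≡m; n%n≡0)
open import Data.Nat.Primality using (Prime; prime⇒nonZero; prime⇒nonTrivial; euclidsLemma)
import Data.Nat.Properties as ℕ
open import Data.Product.Base using (∃; _×_; _,_; proj₁; proj₂; swap)
open import Data.Product.Properties using (≡-dec)
open import Data.Refinement using (Refinement-syntax; _,_)
open import Data.Refinement.Properties using (value-injective)
open import Data.Sum.Base using (_⊎_; inj₁; inj₂)
open import Function.Base using (_∘_)
open import Level using (0ℓ)
open import Relation.Binary.Bundles using (Setoid)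
open import Relation.Binary.Construct.Closure.ReflexiveTransitive using (Star)
open import Relation.Binary.PropositionalEquality
open import Relation.Nullary using (¬_; Dec; yes; no; contradiction)
open import Relation.Nullary.Decidable using (_⊎-dec_)

-- A finite multigraph is a Multigraph (Fin u) (Fin m): u vertices and
-- m directed edges.  The vertex and edge types are left general so that
-- V × G and E × G can be used for derived multigraphs.

record Multigraph (V E : Set) : Set where
  field
    inc     : E → V × V
    inv     : E → E
    inv-inv : ∀ e → inv (inv e) ≡ e
    inv≢    : ∀ e → inv e ≢ e
    inc-inv : ∀ e → inc (inv e) ≡ swap (inc e)

  o t : E → V
  o = proj₁ ∘ inc
  t = proj₂ ∘ inc

  -- The kernel of the quotient map π.
  infix 4 _∼_
  _∼_ : E → E → Set
  e ∼ e′ = e ≡ e′ ⊎ inv e ≡ e′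

  ∼-sym : ∀ {e e′} → e ∼ e′ → e′ ∼ e
  ∼-sym (inj₁ refl) = inj₁ refl
  ∼-sym (inj₂ refl) = inj₂ (inv-inv _)

  ∼-trans : ∀ {e e′ e″} → e ∼ e′ → e′ ∼ e″ → e ∼ e″
  ∼-trans (inj₁ refl) q           = q
  ∼-trans (inj₂ refl) (inj₁ refl) = inj₂ refl
  ∼-trans (inj₂ refl) (inj₂ refl) = inj₁ (sym (inv-inv _))

  -- E_X = E_X⁺/ι, the quotient being rendered as a setoid; the quotient
  -- map π is then the identity on carriers.
  undirected : Setoid 0ℓ 0ℓ
  undirected = record
    { Carrier       = E
    ; _≈_           = _∼_
    ; isEquivalence = record { refl = inj₁ refl ; sym = ∼-sym ; trans = ∼-trans }
    }

  Adjacent : V → V → Set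
  Adjacent v w = ∃ λ e → inc e ≡ (v , w)

  Connected : Set
  Connected = ∀ v w → Star Adjacent v w

  -- A section γ : E_X → E_X⁺ of π, as a function on directed edges that
  -- factors through the quotient.
  record Section : Set where
    field
      γ      : E → E
      γ-cong : ∀ {e e′} → e ∼ e′ → γ e ≡ γ e′
      π∘γ    : ∀ e → γ e ∼ e

module _ {u m : ℕ} (X : Multigraph (Fin u) (Fin m)) where
  open Multigraph X

  _∼?_ : ∀ e e′ → Dec (e ∼ e′)
  e ∼? e′ = (e Fin.≟ e′) ⊎-dec (inv e Fin.≟ e′)

  #undirected : ℕ
  #undirected = length (deduplicate _∼?_ (allFin m))

  χ : ℤ
  χ = + u ℤ.- + #undirected

  valency : Fin u → ℕ
  valency v = length (filter (λ e → o e Fin.≟ v) (allFin m))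

module Image {u m : ℕ} {X : Multigraph (Fin u) (Fin m)}
             (sec : Multigraph.Section X) where
  open Multigraph X
  open Section sec

  InS : Fin m → Set
  InS s = ∃ λ e → γ e ≡ s

  inS? : ∀ e → Dec (InS e)
  inS? e = Fin.any? (λ e′ → γ e′ Fin.≟ e)

  -- Membership proofs are irrelevant, so that S is a subset of E_X⁺.
  S : Set
  S = [ s ∈ Fin m ∣ InS s ]

  γ≡inv : ∀ e → ¬ InS e → γ e ≡ inv e
  γ≡inv e e∉S with π∘γ e
  ... | inj₁ γe≡e = contradiction (e , γe≡e) e∉S
  ... | inj₂ p    = trans (sym (inv-inv (γ e))) (cong inv p)

  inv∈S : ∀ e → ¬ InS e → InS (inv e)
  inv∈S e e∉S = e , γ≡inv e e∉S

  inv∉S : ∀ e → InS e → ¬ InS (inv e)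
  inv∉S e (a , γa≡e) (b , γb≡ē) = inv≢ e (trans (sym γb≡ē) (trans (γ-cong b∼a) γa≡e))
    where
    b∼e : b ∼ e
    b∼e = ∼-trans (∼-sym (π∘γ b)) (subst (_∼ e) (sym γb≡ē) (inj₂ (inv-inv e)))
    b∼a : b ∼ a
    b∼a = ∼-trans b∼e (subst (_∼ a) γa≡e (π∘γ a))

module Derived {u m : ℕ} {X : Multigraph (Fin u) (Fin m)} (sec : Multigraph.Section X)
               {G : Set} {_+_ : G → G → G} {0# : G} { -_ : G → G}
               (isAbelianGroup : IsAbelianGroup _≡_ _+_ 0# -_)
               (β : Image.S sec → G) where
  open Multigraph X
  open Image sec
  open IsAbelianGroup isAbelianGroup using (isGroup; assoc; identityʳ; inverseʳ)

  β⁺ : Fin m → G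
  β⁺ e with inS? e
  ... | yes e∈S = β (e , [ e∈S ])
  ... | no  e∉S = - β (inv e , [ inv∈S e e∉S ])

  private
    group : Group 0ℓ 0ℓ
    group = record { isGroup = isGroup }

    open GroupProperties group using (⁻¹-involutive)

    cancel : ∀ σ g → (σ + g) + (- g) ≡ σ
    cancel σ g = trans (assoc σ g (- g)) (trans (cong (λ h → σ + h) (inverseʳ g)) (identityʳ σ))

  β⁺-inv : ∀ e → β⁺ (inv e) ≡ - β⁺ e
  β⁺-inv e with inS? e | inS? (inv e)
  ... | yes p | yes q = contradiction q (inv∉S e p)
  ... | yes p | no  q = cong (-_ ∘ β) (value-injective (inv-inv e))
  ... | no  p | yes q = sym (⁻¹-involutive _)
  ... | no  p | no  q = contradiction (inv∈S e p) q

  derived : Multigraph (Fin u × G) (Fin m × G)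
  derived = record
    { inc     = λ (e , σ) → (o e , σ) , (t e , σ + β⁺ e)
    ; inv     = λ (e , σ) → inv e , σ + β⁺ e
    ; inv-inv = λ (e , σ) → cong₂ _,_ (inv-inv e) (σ+β-β e σ)
    ; inv≢    = λ (e , σ) p → inv≢ e (cong proj₁ p)
    ; inc-inv = λ (e , σ) → cong₂ _,_
        (cong (_, σ + β⁺ e) (cong proj₁ (inc-inv e)))
        (cong₂ _,_ (cong proj₂ (inc-inv e)) (σ+β-β e σ))
    }
    where
    σ+β-β : ∀ e σ → (σ + β⁺ e) + β⁺ (inv e) ≡ σ
    σ+β-β e σ = trans (cong (λ h → (σ + β⁺ e) + h) (β⁺-inv e)) (cancel σ (β⁺ e))

module ℤ/ (N : ℕ) .{{_ : NonZero N}} where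

  infixl 6 _+ₘ_
  _+ₘ_ : Fin N → Fin N → Fin N
  i +ₘ j = (toℕ i ℕ.+ toℕ j) mod N

  0ₘ : Fin N
  0ₘ = 0 mod N

  -ₘ_ : Fin N → Fin N
  -ₘ i = (N ∸ toℕ i) mod N

  reduce : ℤ → Fin N
  reduce z = fromℕ< (ℤ.n%ℕd<d z N)

  private
    toℕ-mod : ∀ k → toℕ (k mod N) ≡ k % N
    toℕ-mod k = Fin.toℕ-fromℕ< (m%n<n k N)

    toℕ% : ∀ (i : Fin N) → toℕ i % N ≡ toℕ i
    toℕ% i = m<n⇒m%n≡m (Fin.toℕ<n i)

    %-absorbˡ : ∀ a b → (a % N ℕ.+ b) % N ≡ (a ℕ.+ b) % N
    %-absorbˡ a b = begin
      (a % N ℕ.+ b) % N             ≡⟨ %-distribˡ-+ (a % N) b N ⟩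
      (a % N % N ℕ.+ b % N) % N     ≡⟨ cong (λ c → (c ℕ.+ b % N) % N) (m%n%n≡m%n a N) ⟩
      (a % N ℕ.+ b % N) % N         ≡⟨ %-distribˡ-+ a b N ⟨
      (a ℕ.+ b) % N                 ∎
      where open ≡-Reasoning

    comm : ∀ i j → i +ₘ j ≡ j +ₘ i
    comm i j = cong (_mod N) (ℕ.+-comm (toℕ i) (toℕ j))

    toℕ-+ₘ-assoc : ∀ i j k → toℕ ((i +ₘ j) +ₘ k) ≡ (toℕ i ℕ.+ toℕ j ℕ.+ toℕ k) % N
    toℕ-+ₘ-assoc i j k = begin
      toℕ ((i +ₘ j) +ₘ k)                         ≡⟨ toℕ-mod _ ⟩
      (toℕ (i +ₘ j) ℕ.+ toℕ k) % N                ≡⟨ cong (λ c → (c ℕ.+ toℕ k) % N) (toℕ-mod _) ⟩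
      ((toℕ i ℕ.+ toℕ j) % N ℕ.+ toℕ k) % N       ≡⟨ %-absorbˡ _ (toℕ k) ⟩
      (toℕ i ℕ.+ toℕ j ℕ.+ toℕ k) % N             ∎
      where open ≡-Reasoning

    assoc : ∀ i j k → (i +ₘ j) +ₘ k ≡ i +ₘ (j +ₘ k)
    assoc i j k = Fin.toℕ-injective (begin
      toℕ ((i +ₘ j) +ₘ k)                 ≡⟨ toℕ-+ₘ-assoc i j k ⟩
      (toℕ i ℕ.+ toℕ j ℕ.+ toℕ k) % N     ≡⟨ cong (_% N) (ℕ.+-assoc (toℕ i) _ _) ⟩
      (toℕ i ℕ.+ (toℕ j ℕ.+ toℕ k)) % N   ≡⟨ cong (_% N) (ℕ.+-comm (toℕ i) _) ⟩
      (toℕ j ℕ.+ toℕ k ℕ.+ toℕ i) % N     ≡⟨ toℕ-+ₘ-assoc j k i ⟨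
      toℕ ((j +ₘ k) +ₘ i)                 ≡⟨ cong toℕ (comm (j +ₘ k) i) ⟩
      toℕ (i +ₘ (j +ₘ k))                 ∎)
      where open ≡-Reasoning

    identityˡ : ∀ i → 0ₘ +ₘ i ≡ i
    identityˡ i = Fin.toℕ-injective (begin
      toℕ (0ₘ +ₘ i)           ≡⟨ toℕ-mod _ ⟩
      (toℕ 0ₘ ℕ.+ toℕ i) % N  ≡⟨ cong (λ c → (c ℕ.+ toℕ i) % N) (toℕ-mod 0) ⟩
      (0 % N ℕ.+ toℕ i) % N   ≡⟨ %-absorbˡ 0 (toℕ i) ⟩
      toℕ i % N               ≡⟨ toℕ% i ⟩
      toℕ i                   ∎)
      where open ≡-Reasoning

    inverseˡ : ∀ i → (-ₘ i) +ₘ i ≡ 0ₘ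
    inverseˡ i = Fin.toℕ-injective (begin
      toℕ ((-ₘ i) +ₘ i)                 ≡⟨ toℕ-mod _ ⟩
      (toℕ (-ₘ i) ℕ.+ toℕ i) % N        ≡⟨ cong (λ c → (c ℕ.+ toℕ i) % N) (toℕ-mod _) ⟩
      ((N ∸ toℕ i) % N ℕ.+ toℕ i) % N   ≡⟨ %-absorbˡ _ (toℕ i) ⟩
      (N ∸ toℕ i ℕ.+ toℕ i) % N         ≡⟨ cong (_% N) (ℕ.m∸n+n≡m (ℕ.<⇒≤ (Fin.toℕ<n i))) ⟩
      N % N                             ≡⟨ n%n≡0 N ⟩
      0                                 ≡⟨ m<n⇒m%n≡m (ℕ.>-nonZero⁻¹ N) ⟨
      0 % N                             ≡⟨ toℕ-mod 0 ⟨
      toℕ 0ₘ                            ∎)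
      where open ≡-Reasoning

  isAbelianGroup : IsAbelianGroup _≡_ _+ₘ_ 0ₘ -ₘ_
  isAbelianGroup = record
    { isGroup = record
      { isMonoid = record
        { isSemigroup = record
          { isMagma = isMagma _+ₘ_
          ; assoc   = assoc
          }
        ; identity = identityˡ , λ i → trans (comm i 0ₘ) (identityˡ i)
        }
      ; inverse = inverseˡ , λ i → trans (comm i (-ₘ i)) (inverseˡ i)
      ; ⁻¹-cong = cong -ₘ_
      }
    ; comm = comm
    }
    where open import Relation.Binary.PropositionalEquality.Algebra using (isMagma)

module _ (R : RawRing 0ℓ 0ℓ) where
  open RawRing R
  open RawMonoidDefs +-rawMonoid using (sum)

  alternate : ℕ → Carrier → Carrier
  alternate zero    x = x
  alternate (suc k) x = - alternate k x

  -- Expansion along the first row.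
  det : ∀ {n} → (Fin n → Fin n → Carrier) → Carrier
  det {zero}  A = 1#
  det {suc n} A =
    sum (λ j → alternate (toℕ j) (A zero j * det (λ i k → A (suc i) (punchIn j k))))

  constant : Carrier → (ℕ → Carrier)
  constant a zero    = a
  constant a (suc _) = 0#

  -- R[[T]], a series being its sequence of coefficients.
  powerSeries : RawRing 0ℓ 0ℓ
  powerSeries = record
    { Carrier = ℕ → Carrier
    ; _≈_     = λ f g → ∀ n → f n ≈ g n
    ; _+_     = λ f g n → f n + g n
    ; _*_     = λ f g n → sum {suc n} (λ i → f (toℕ i) * g (n ∸ toℕ i))
    ; -_      = λ f n → - f n
    ; 0#      = constant 0#
    ; 1#      = constant 1#
    }

module ℓ-adic (ℓ : ℕ) (ℓ-prime : Prime ℓ) where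

  ℓ^n≢0 : ∀ n → NonZero (ℓ ^ n)
  ℓ^n≢0 n = ℕ.m^n≢0 ℓ n {{prime⇒nonZero ℓ-prime}}

  infix 4 _≡_mod-ℓ^_
  record _≡_mod-ℓ^_ (a b : ℤ) (n : ℕ) : Set where
    constructor ≡-mod
    field ℓ^n∣a-b : + (ℓ ^ n) ∣ a ℤ.- b
  open _≡_mod-ℓ^_ public

  -- ℤ_ℓ as the inverse limit of the ℤ/ℓⁿ: `at n` represents the n-th
  -- component, and only its class modulo ℓⁿ is significant.
  record ℤₗ : Set where
    constructor mkℤₗ
    field
      at       : ℕ → ℤ
      coherent : ∀ n → at (suc n) ≡ at n mod-ℓ^ n
  open ℤₗ public

  abstract
    ≡ᵐ-reflexive : ∀ {n a b} → a ≡ b → a ≡ b mod-ℓ^ n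
    ≡ᵐ-reflexive {a = a} refl = ≡-mod (divides 0ℤ (ℤ.+-inverseʳ a))

    ≡ᵐ-sym : ∀ {n a b} → a ≡ b mod-ℓ^ n → b ≡ a mod-ℓ^ n
    ≡ᵐ-sym {n} {a} {b} (≡-mod p) = ≡-mod (subst (+ (ℓ ^ n) ∣_) (lem a b) (ℤ.∣m⇒∣-m p))
      where lem : ∀ a b → ℤ.- (a ℤ.- b) ≡ b ℤ.- a
            lem = solve-∀

    ≡ᵐ-trans : ∀ {n a b c} → a ≡ b mod-ℓ^ n → b ≡ c mod-ℓ^ n → a ≡ c mod-ℓ^ n
    ≡ᵐ-trans {n} {a} {b} {c} (≡-mod p) (≡-mod q) =
      ≡-mod (subst (+ (ℓ ^ n) ∣_) (lem a b c) (ℤ.∣m∣n⇒∣m+n p q))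
      where lem : ∀ a b c → (a ℤ.- b) ℤ.+ (b ℤ.- c) ≡ a ℤ.- c
            lem = solve-∀

    ≡ᵐ-+ : ∀ {n a b c d} → a ≡ b mod-ℓ^ n → c ≡ d mod-ℓ^ n → a ℤ.+ c ≡ b ℤ.+ d mod-ℓ^ n
    ≡ᵐ-+ {n} {a} {b} {c} {d} (≡-mod p) (≡-mod q) =
      ≡-mod (subst (+ (ℓ ^ n) ∣_) (lem a b c d) (ℤ.∣m∣n⇒∣m+n p q))
      where lem : ∀ a b c d → (a ℤ.- b) ℤ.+ (c ℤ.- d) ≡ (a ℤ.+ c) ℤ.- (b ℤ.+ d)
            lem = solve-∀

    ≡ᵐ-* : ∀ {n a b c d} → a ≡ b mod-ℓ^ n → c ≡ d mod-ℓ^ n → a ℤ.* c ≡ b ℤ.* d mod-ℓ^ n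
    ≡ᵐ-* {n} {a} {b} {c} {d} (≡-mod p) (≡-mod q) =
      ≡-mod (subst (+ (ℓ ^ n) ∣_) (lem a b c d) (ℤ.∣m∣n⇒∣m+n (ℤ.∣m⇒∣m*n c p) (ℤ.∣n⇒∣m*n b q)))
      where lem : ∀ a b c d → (a ℤ.- b) ℤ.* c ℤ.+ b ℤ.* (c ℤ.- d) ≡ a ℤ.* c ℤ.- b ℤ.* d
            lem = solve-∀

    ≡ᵐ-neg : ∀ {n a b} → a ≡ b mod-ℓ^ n → ℤ.- a ≡ ℤ.- b mod-ℓ^ n
    ≡ᵐ-neg {n} {a} {b} (≡-mod p) = ≡-mod (subst (+ (ℓ ^ n) ∣_) (lem a b) (ℤ.∣m⇒∣-m p))
      where lem : ∀ a b → ℤ.- (a ℤ.- b) ≡ ℤ.- a ℤ.- (ℤ.- b)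
            lem = solve-∀

    ≡ᵐ-weaken : ∀ k e {a b} → a ≡ b mod-ℓ^ (k ℕ.+ e) → a ≡ b mod-ℓ^ k
    ≡ᵐ-weaken k e (≡-mod p) = ≡-mod (ℤ.∣-trans
      (ℤ.∣ᵤ⇒∣ (subst (ℓ ^ k ℕ.∣_) (sym (ℕ.^-distribˡ-+-* ℓ k e)) (ℕ.m∣m*n (ℓ ^ e)))) p)

    at-+ : ∀ (b : ℤₗ) k e → at b (k ℕ.+ e) ≡ at b k mod-ℓ^ k
    at-+ b k zero    = ≡ᵐ-reflexive (cong (at b) (ℕ.+-identityʳ k))
    at-+ b k (suc e) = ≡ᵐ-trans
      (≡ᵐ-weaken k e (subst (λ j → at b j ≡ at b (k ℕ.+ e) mod-ℓ^ (k ℕ.+ e))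
                            (sym (ℕ.+-suc k e)) (coherent b (k ℕ.+ e))))
      (at-+ b k e)

  fromℤ : ℤ → ℤₗ
  fromℤ z = mkℤₗ (λ _ → z) (λ _ → ≡ᵐ-reflexive refl)

  ℤₗ-rawRing : RawRing 0ℓ 0ℓ
  ℤₗ-rawRing = record
    { Carrier = ℤₗ
    ; _≈_     = λ x y → ∀ n → at x n ≡ at y n mod-ℓ^ n
    ; _+_     = λ x y → mkℤₗ (λ n → at x n ℤ.+ at y n) (λ n → ≡ᵐ-+ (coherent x n) (coherent y n))
    ; _*_     = λ x y → mkℤₗ (λ n → at x n ℤ.* at y n) (λ n → ≡ᵐ-* (coherent x n) (coherent y n))
    ; -_      = λ x → mkℤₗ (λ n → ℤ.- at x n) (λ n → ≡ᵐ-neg (coherent x n))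
    ; 0#      = fromℤ 0ℤ
    ; 1#      = fromℤ 1ℤ
    }

  reduce : ∀ n → ℤₗ → Fin (ℓ ^ n)
  reduce n x = ℤ/.reduce (ℓ ^ n) {{ℓ^n≢0 n}} (at x n)

  module _ where
    open RawRing ℤₗ-rawRing

    falling : ℤₗ → ℕ → ℤₗ
    falling b zero    = 1#
    falling b (suc n) = falling b n * (b + - fromℤ (+ n))

  fallingℤ : ℤ → ℕ → ℤ
  fallingℤ z zero    = 1ℤ
  fallingℤ z (suc n) = fallingℤ z n ℤ.* (z ℤ.+ ℤ.- (+ n))

  residue : ℤₗ → ℕ → ℕ
  residue b k = (at b k %ℕ (ℓ ^ k)) {{ℓ^n≢0 k}}

  abstract
    at-falling : ∀ b n k → at (falling b n) k ≡ fallingℤ (at b k) n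
    at-falling b zero    k = refl
    at-falling b (suc n) k = cong (ℤ._* (at b k ℤ.+ ℤ.- (+ n))) (at-falling b n k)

    fallingℤ-cong : ∀ {k a b} → a ≡ b mod-ℓ^ k → ∀ n → fallingℤ a n ≡ fallingℤ b n mod-ℓ^ k
    fallingℤ-cong p zero    = ≡ᵐ-reflexive refl
    fallingℤ-cong p (suc n) = ≡ᵐ-* (fallingℤ-cong p n) (≡ᵐ-+ p (≡ᵐ-reflexive {a = ℤ.- (+ n)} refl))

    fallingℤ-suc : ∀ z n → (1ℤ ℤ.+ z) ℤ.* fallingℤ z n ≡ fallingℤ (1ℤ ℤ.+ z) (suc n)
    fallingℤ-suc z zero    = lem z
      where lem : ∀ z → (1ℤ ℤ.+ z) ℤ.* 1ℤ ≡ 1ℤ ℤ.* ((1ℤ ℤ.+ z) ℤ.+ ℤ.- 0ℤ)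
            lem = solve-∀
    fallingℤ-suc z (suc n) = begin
      (1ℤ ℤ.+ z) ℤ.* (fallingℤ z n ℤ.* (z ℤ.+ ℤ.- (+ n)))
        ≡⟨ lem z (fallingℤ z n) (+ n) ⟩
      ((1ℤ ℤ.+ z) ℤ.* fallingℤ z n) ℤ.* ((1ℤ ℤ.+ z) ℤ.+ ℤ.- (1ℤ ℤ.+ + n))
        ≡⟨ cong (ℤ._* ((1ℤ ℤ.+ z) ℤ.+ ℤ.- (+ suc n))) (fallingℤ-suc z n) ⟩
      fallingℤ (1ℤ ℤ.+ z) (suc (suc n)) ∎
      where
      open ≡-Reasoning
      lem : ∀ z f n → (1ℤ ℤ.+ z) ℤ.* (f ℤ.* (z ℤ.+ ℤ.- n))
                    ≡ ((1ℤ ℤ.+ z) ℤ.* f) ℤ.* ((1ℤ ℤ.+ z) ℤ.+ ℤ.- (1ℤ ℤ.+ n))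
      lem = solve-∀

    n!*C : ∀ a n → + (n !) ℤ.* + (a C n) ≡ fallingℤ (+ a) n
    n!*C a       zero    = refl
    n!*C zero    (suc n) = trans (cong (λ c → + (suc n !) ℤ.* + c) (k>n⇒nCk≡0 {0} {suc n} ℕ.z<s))
                          (trans (ℤ.*-zeroʳ (+ (suc n !))) (sym (falling-0 n)))
      where
      falling-0 : ∀ n → fallingℤ 0ℤ (suc n) ≡ 0ℤ
      falling-0 zero    = refl
      falling-0 (suc n) = cong (ℤ._* (0ℤ ℤ.+ ℤ.- (+ suc n))) (falling-0 n)
    n!*C (suc a) (suc n) = begin
      + (suc n !) ℤ.* + (suc a C suc n)
        ≡⟨ cong (λ c → + (suc n !) ℤ.* + c) (nCk+nC[k+1]≡[n+1]C[k+1] a n) ⟨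
      + (suc n !) ℤ.* + (a C n ℕ.+ a C suc n)
        ≡⟨ cong (+ (suc n !) ℤ.*_) (ℤ.pos-+ (a C n) (a C suc n)) ⟩
      + (suc n !) ℤ.* (+ (a C n) ℤ.+ + (a C suc n))
        ≡⟨ ℤ.*-distribˡ-+ (+ (suc n !)) (+ (a C n)) (+ (a C suc n)) ⟩
      + (suc n !) ℤ.* + (a C n) ℤ.+ + (suc n !) ℤ.* + (a C suc n)
        ≡⟨ cong₂ ℤ._+_ (cong (ℤ._* + (a C n)) (ℤ.pos-* (suc n) (n !))) (n!*C a (suc n)) ⟩
      + suc n ℤ.* + (n !) ℤ.* + (a C n) ℤ.+ fallingℤ (+ a) (suc n)
        ≡⟨ cong (ℤ._+ fallingℤ (+ a) (suc n))
             (trans (ℤ.*-assoc (+ suc n) (+ (n !)) (+ (a C n))) (cong (+ suc n ℤ.*_) (n!*C a n))) ⟩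
      + suc n ℤ.* fallingℤ (+ a) n ℤ.+ fallingℤ (+ a) (suc n)
        ≡⟨ lem (+ a) (+ n) (fallingℤ (+ a) n) ⟩
      (1ℤ ℤ.+ + a) ℤ.* fallingℤ (+ a) n
        ≡⟨ fallingℤ-suc (+ a) n ⟩
      fallingℤ (+ suc a) (suc n) ∎
      where
      open ≡-Reasoning
      lem : ∀ a n f → (1ℤ ℤ.+ n) ℤ.* f ℤ.+ f ℤ.* (a ℤ.+ ℤ.- n) ≡ (1ℤ ℤ.+ a) ℤ.* f
      lem = solve-∀

    n<ℓ^n : ∀ n → n ℕ.< ℓ ^ n
    n<ℓ^n zero    = ℕ.z<s
    n<ℓ^n (suc n) = ℕ.<-≤-trans (ℕ.s≤s (n<ℓ^n n))
      (subst (suc (ℓ ^ n) ℕ.≤_) (ℕ.*-comm (ℓ ^ n) ℓ) (ℕ.m<m*n (ℓ ^ n) ℓ {{ℓ^n≢0 n}} 1<ℓ))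
      where 1<ℓ : 1 ℕ.< ℓ
            1<ℓ = ℕ.nonTrivial⇒n>1 ℓ {{prime⇒nonTrivial ℓ-prime}}

    cancel-unit : ∀ e m q → ¬ ℓ ℕ.∣ q → ℓ ^ e ℕ.∣ m ℕ.* q → ℓ ^ e ℕ.∣ m
    cancel-unit zero    m q ℓ∤q p = ℕ.1∣ m
    cancel-unit (suc e) m q ℓ∤q p
      with euclidsLemma m q ℓ-prime (ℕ.∣-trans (ℕ.m∣m*n (ℓ ^ e)) p)
    ... | inj₂ ℓ∣q                  = contradiction ℓ∣q ℓ∤q
    ... | inj₁ (ℕ.divides m′ refl) =
      subst (ℓ ^ suc e ℕ.∣_) (ℕ.*-comm ℓ m′)
        (ℕ.*-monoʳ-∣ ℓ (cancel-unit e m′ q ℓ∤q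
          (ℕ.*-cancelˡ-∣ ℓ {{prime⇒nonZero ℓ-prime}} (subst (ℓ ^ suc e ℕ.∣_) eq p))))
      where
      eq : m′ ℕ.* ℓ ℕ.* q ≡ ℓ ℕ.* (m′ ℕ.* q)
      eq = trans (cong (ℕ._* q) (ℕ.*-comm m′ ℓ)) (ℕ.*-assoc ℓ m′ q)

    divide-out : ∀ k m d .{{_ : NonZero m}} → ℓ ^ (k ℕ.+ m) ℕ.∣ m ℕ.* d → ℓ ^ k ℕ.∣ d
    divide-out zero    m d p = ℕ.1∣ d
    divide-out (suc k) m d p with divide-out k m d (ℕ.∣-trans (ℕ.n∣m*n ℓ) p)
    ... | ℕ.divides q refl with ℓ ℕ.∣? q
    ...   | yes ℓ∣q = ℕ.*-monoˡ-∣ (ℓ ^ k) ℓ∣q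
    ...   | no  ℓ∤q = contradiction
      (ℕ.∣⇒≤ (cancel-unit (suc m) m q ℓ∤q (ℕ.*-cancelʳ-∣ (ℓ ^ k) {{ℓ^n≢0 k}} (subst₂ ℕ._∣_ eq₁ eq₂ p))))
      (ℕ.<⇒≱ (ℕ.<-trans (ℕ.n<1+n m) (n<ℓ^n (suc m))))
      where
      eq₁ : ℓ ^ (suc k ℕ.+ m) ≡ ℓ ^ suc m ℕ.* ℓ ^ k
      eq₁ = trans (cong (λ j → ℓ ^ suc j) (ℕ.+-comm k m)) (ℕ.^-distribˡ-+-* ℓ (suc m) k)
      eq₂ : m ℕ.* (q ℕ.* ℓ ^ k) ≡ m ℕ.* q ℕ.* ℓ ^ k
      eq₂ = sym (ℕ.*-assoc m q (ℓ ^ k))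

    residue≡at : ∀ b k → + residue b k ≡ at b k mod-ℓ^ k
    residue≡at b k = ≡ᵐ-sym (≡-mod (divides ((at b k /ℕ (ℓ ^ k)) {{ℓ^n≢0 k}})
      (trans (cong (ℤ._- + r) (ℤ.a≡a%ℕn+[a/ℕn]*n (at b k) (ℓ ^ k) {{ℓ^n≢0 k}})) (lem (+ r) _))))
      where
      r : ℕ
      r = residue b k
      lem : ∀ r q → (r ℤ.+ q) ℤ.- r ≡ q
      lem = solve-∀

    residue-coherent : ∀ b k → + residue b (suc k) ≡ + residue b k mod-ℓ^ k
    residue-coherent b k =
      ≡ᵐ-trans (≡ᵐ-weaken k 1 (subst (λ j → + residue b (suc k) ≡ at b (suc k) mod-ℓ^ j) (ℕ.+-comm 1 k)
                                     (residue≡at b (suc k))))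
      (≡ᵐ-trans (coherent b k) (≡ᵐ-sym (residue≡at b k)))

    binomial-coherent : ∀ b n k → + (residue b (suc k ℕ.+ n !) C n) ≡ + (residue b (k ℕ.+ n !) C n) mod-ℓ^ k
    binomial-coherent b n k = ≡-mod (ℤ.∣ᵤ⇒∣ (divide-out k (n !) ℤ.∣ c′ ℤ.- c ∣ {{n ℕ.!≢0}}
      (subst (ℓ ^ (k ℕ.+ n !) ℕ.∣_) (ℤ.abs-* (+ (n !)) (c′ ℤ.- c)) (ℤ.∣⇒∣ᵤ n!-multiple))))
      where
      c′ c : ℤ
      c′ = + (residue b (suc k ℕ.+ n !) C n)
      c  = + (residue b (k ℕ.+ n !) C n)
      lem : ∀ f c′ c → f ℤ.* c′ ℤ.- f ℤ.* c ≡ f ℤ.* (c′ ℤ.- c)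
      lem = solve-∀
      n!-multiple : + (ℓ ^ (k ℕ.+ n !)) ∣ + (n !) ℤ.* (c′ ℤ.- c)
      n!-multiple = subst (+ (ℓ ^ (k ℕ.+ n !)) ∣_)
        (trans (cong₂ ℤ._-_ (sym (n!*C _ n)) (sym (n!*C _ n))) (lem (+ (n !)) c′ c))
        (ℓ^n∣a-b (fallingℤ-cong (residue-coherent b (k ℕ.+ n !)) n))

  -- At level k the integer binomial coefficient C(a, n) is used with a a
  -- residue of b modulo ℓ^(k + n!): since v_ℓ(n!) < n!, the class of
  -- C(a, n) modulo ℓ^k then depends on b only.  See binomial-spec.
  binomial : ℤₗ → ℕ → ℤₗ
  binomial b n = mkℤₗ (λ k → + (residue b (k ℕ.+ n !) C n)) (binomial-coherent b n)

  abstract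
    binomial-spec : let open RawRing ℤₗ-rawRing in
                    ∀ b n → fromℤ (+ (n !)) * binomial b n ≈ falling b n
    binomial-spec b n k =
      ≡ᵐ-trans (≡ᵐ-reflexive (n!*C _ n))
      (≡ᵐ-trans (fallingℤ-cong (≡ᵐ-trans (≡ᵐ-weaken k (n !) (residue≡at b (k ℕ.+ n !)))
                                         (at-+ b k (n !))) n)
                (≡ᵐ-reflexive (sym (at-falling b n k))))

  ℤₗ[[T]] : RawRing 0ℓ 0ℓ
  ℤₗ[[T]] = powerSeries ℤₗ-rawRing

  [1+T]^_ : ℤₗ → RawRing.Carrier ℤₗ[[T]]
  [1+T]^ b = binomial b

  scalar : ℤ → RawRing.Carrier ℤₗ[[T]]
  scalar z = constant ℤₗ-rawRing (fromℤ z)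

  -- The series g is a distinguished polynomial of degree d.
  record IsDistinguished (d : ℕ) (g : ℕ → ℤₗ) : Set where
    open RawRing ℤₗ-rawRing
    open RawMagmaDefs *-rawMagma using () renaming (_∣_ to _∣ₗ_)
    field
      leading : g d ≈ 1#
      lower   : ∀ n → n ℕ.< d → fromℤ (+ ℓ) ∣ₗ g n
      upper   : ∀ n → d ℕ.< n → g n ≈ 0#

  record WeierstrassFactorisation (f : RawRing.Carrier ℤₗ[[T]]) : Set where
    open RawRing ℤₗ[[T]]
    field
      μ               : ℕ
      degree          : ℕ
      g u             : Carrier
      g-distinguished : IsDistinguished degree g
      u-unit          : ∃ λ v → u * v ≈ 1#
      factorisation   : f ≈ scalar (+ (ℓ ^ μ)) * g * u

  module Characteristic {u m : ℕ} (X : Multigraph (Fin u) (Fin m))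
                        (sec : Multigraph.Section X)
                        (α : Image.S sec → ℤₗ) where
    open Multigraph X
    open Image sec
    open RawRing ℤₗ[[T]]
    open RawMonoidDefs +-rawMonoid using (sum)

    α/ : ∀ n → S → Fin (ℓ ^ n)
    α/ n s = reduce n (α s)

    X/ : ∀ n → Multigraph (Fin u × Fin (ℓ ^ n)) (Fin m × Fin (ℓ ^ n))
    X/ n = Derived.derived sec (ℤ/.isAbelianGroup (ℓ ^ n) {{ℓ^n≢0 n}}) (α/ n)

    -- The sum of h(s) over the s ∈ S with i(s) = p.
    ∑S : Fin u × Fin u → (S → Carrier) → Carrier
    ∑S p h = sum term
      where
      term : Fin m → Carrier
      term e with inS? e | ≡-dec Fin._≟_ Fin._≟_ (inc e) p
      ... | yes e∈S | yes _ = h (e , [ e∈S ])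
      ... | yes _   | no  _ = 0#
      ... | no  _   | _     = 0#

    D : Fin u → Fin u → Carrier
    D i j with i Fin.≟ j
    ... | yes _ = scalar (+ valency X i)
    ... | no  _ = 0#

    M : Fin u → Fin u → Carrier
    M i j = D i j + - ( ∑S (i , j) (λ s → [1+T]^ (α s))
                      + ∑S (j , i) (λ s → [1+T]^ (RawRing.-_ ℤₗ-rawRing (α s))))

    f : Carrier
    f = det ℤₗ[[T]] M

    -- λ_ℓ(X, α).  A Weierstrass factorisation of f, unique by the
    -- preparation theorem, is taken as an argument because it cannot be
    -- computed from α: deciding which coefficients of f vanish modulo ℓ^k
    -- would require deciding equality in ℤ_ℓ.
    λ-invariant : WeierstrassFactorisation f → ℤ
    λ-invariant W = + WeierstrassFactorisation.degree W ℤ.- 1ℤ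

Odd : ℤ → Set
Odd z = ∃ λ k → z ≡ + 2 ℤ.* k ℤ.+ 1ℤ

{-# OPTIONS --safe #-}

-- The substitution T ↦ S = (1+T)⁻¹ - 1 exchanges (1+T)^α and (1+T)^-α, so it
-- transposes M and fixes f = det M.  Let d be the degree of g.  Modulo ℓ^(μ+1)
-- and T^(d+1) the series f is c T^d, where c has exact ℓ-adic valuation μ.  Since
-- S = -T + ⋯, invariance gives c ≡ (-1)^d c, and as ℓ is odd, d must be even.
-- Over (ℤ/ℓ^(μ+1))[T]/(T^(d+1)) every (1+T)^α is an ordinary power of 1+T, so
-- that the substitution only has to be applied to polynomials.
module Submission where

open import Defs
open import Algebra.Bundles using (RawRing; CommutativeRing)
import Algebra.Definitions.RawMonoid as RawMonoidDefs
open import Algebra.Morphism.Structures using (module RingMorphisms)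
import Algebra.Properties.CommutativeSemigroup as CommutativeSemigroupProperties
import Algebra.Properties.CommutativeSemiring.Exp as CommutativeExp
import Algebra.Properties.Ring as RingProperties
import Algebra.Properties.Semiring.Exp as Exp
import Algebra.Properties.Semiring.Sum as Sum
open import Data.Fin.Base using (Fin; zero; suc; toℕ; punchIn)
import Data.Fin.Properties as Fin
open import Data.Integer.Base as ℤ using (ℤ; +_; 0ℤ; 1ℤ)
import Data.Integer.Divisibility.Signed as ℤ
import Data.Integer.Properties as ℤ
open import Data.Integer.Tactic.RingSolver using (solve-∀)
open import Data.Irrelevant using ([_])
open import Data.Nat.Base as ℕ using (ℕ; zero; suc; _∸_; _!; _^_; z≤n; s≤s)
open import Data.Nat.Combinatorics using (_C_; nCk+nC[k+1]≡[n+1]C[k+1]; k>n⇒nCk≡0)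
import Data.Nat.Divisibility as ℕ
open import Data.Nat.Primality using (Prime; prime[2]; prime⇒irreducible; ¬prime[1])
import Data.Nat.Properties as ℕ
open import Data.Product.Base using (∃; _×_; _,_; proj₁; proj₂)
open import Data.Product.Properties using (≡-dec)
open import Data.Refinement using (_,_)
open import Data.Sum.Base using (_⊎_; inj₁; inj₂)
open import Function.Base using (_∘_)
open import Level using (0ℓ)
open import Relation.Binary.PropositionalEquality as ≡ using (_≡_; _≢_)
import Relation.Binary.Reasoning.Setoid as SetoidReasoning
open import Relation.Nullary using (¬_; yes; no; contradiction)

-- The ring ℤ_ℓ[[T]] is given by its operations alone, and substituting one power series into
-- another would call for a theory of composition. The substitution is therefore treated as a
-- relation: `f ~ g` records some polynomial with value `f` at T and value `g` at S. Compatibility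
-- with the ring operations then amounts to combining polynomials, and it passes to determinants
-- because these are built from such operations. Ring laws are applied only after reduction, in the
-- truncated ring. There 1+T has finite multiplicative order, a divisor of a power of ℓ, so the
-- inverse of (1+T)^α is again a power with a natural exponent: residues of α and -α to sufficient
-- precision add up to a multiple of that order.

-- Relations compatible with ring operations

record IsRingRelation (R R′ : RawRing 0ℓ 0ℓ)
                      (_~_ : RawRing.Carrier R → RawRing.Carrier R′ → Set) : Set where
  private
    module R = RawRing R
    module R′ = RawRing R′
  field
    +-rel : ∀ {a b a′ b′} → a ~ a′ → b ~ b′ → (a R.+ b) ~ (a′ R′.+ b′)
    *-rel : ∀ {a b a′ b′} → a ~ a′ → b ~ b′ → (a R.* b) ~ (a′ R′.* b′)
    -‿rel : ∀ {a a′} → a ~ a′ → (R.- a) ~ (R′.- a′)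
    0-rel : R.0# ~ R′.0#
    1-rel : R.1# ~ R′.1#

  sum-rel : ∀ {n} {a : Fin n → R.Carrier} {a′ : Fin n → R′.Carrier} → (∀ i → a i ~ a′ i) →
            RawMonoidDefs.sum R.+-rawMonoid a ~ RawMonoidDefs.sum R′.+-rawMonoid a′
  sum-rel {zero}  a~a′ = 0-rel
  sum-rel {suc n} a~a′ = +-rel (a~a′ zero) (sum-rel (a~a′ ∘ suc))

  alternate-rel : ∀ k {a a′} → a ~ a′ → alternate R k a ~ alternate R′ k a′
  alternate-rel zero    a~a′ = a~a′
  alternate-rel (suc k) a~a′ = -‿rel (alternate-rel k a~a′)

  -- Parametricity of `det`, which uses nothing but the ring operations. It is applied twice: to the
  -- graph of the reduction modulo ℓ^N and T^D, and to the substitution relation on ℤ_ℓ[[T]].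
  det-rel : ∀ {n} {A : Fin n → Fin n → R.Carrier} {A′ : Fin n → Fin n → R′.Carrier} →
            (∀ i j → A i j ~ A′ i j) → det R A ~ det R′ A′
  det-rel {zero}  A~A′ = 1-rel
  det-rel {suc n} A~A′ = sum-rel λ j → alternate-rel (toℕ j)
    (*-rel (A~A′ zero j) (det-rel λ i k → A~A′ (suc i) (punchIn j k)))

-- Determinants of transposed matrices

module Determinant (R : CommutativeRing 0ℓ 0ℓ) where
  open CommutativeRing R hiding (zero)
  open RingProperties ring using (-‿+-comm; -0#≈0#; -‿distribʳ-*; -‿involutive)
  open CommutativeSemigroupProperties *-commutativeSemigroup using (x∙yz≈y∙xz)
  open Sum semiring using (sum; sum-cong-≋; *-distribˡ-sum; ∑-comm)
  open SetoidReasoning setoid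

  Matrix : ℕ → Set
  Matrix n = Fin n → Fin n → Carrier

  private
    d : ∀ {n} → Matrix n → Carrier
    d = det rawRing

    alt : ℕ → Carrier → Carrier
    alt = alternate rawRing

  infix 10 _ᵀ
  _ᵀ : ∀ {n} → Matrix n → Matrix n
  (A ᵀ) i j = A j i

  minor : ∀ {n} → Fin (suc n) → Fin (suc n) → Matrix (suc n) → Matrix n
  minor i j A r c = A (punchIn i r) (punchIn j c)

  cong-isRingRelation : IsRingRelation rawRing rawRing _≈_
  cong-isRingRelation = record
    { +-rel = +-cong ; *-rel = *-cong ; -‿rel = -‿cong ; 0-rel = refl ; 1-rel = refl }

  open IsRingRelation cong-isRingRelation using () renaming (alternate-rel to alternate-cong)

  alternate-sum : ∀ k {n} (a : Fin n → Carrier) → alt k (sum a) ≈ sum (alt k ∘ a)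
  alternate-sum zero    a = refl
  alternate-sum (suc k) a = trans (-‿cong (alternate-sum k a)) (neg-sum (alt k ∘ a))
    where
    neg-sum : ∀ {n} (a : Fin n → Carrier) → - sum a ≈ sum (-_ ∘ a)
    neg-sum {zero}  a = -0#≈0#
    neg-sum {suc n} a = trans (sym (-‿+-comm (a zero) _)) (+-congˡ (neg-sum (a ∘ suc)))

  alternate-*ʳ : ∀ k a b → a * alt k b ≈ alt k (a * b)
  alternate-*ʳ zero    a b = refl
  alternate-*ʳ (suc k) a b = trans (sym (-‿distribʳ-* a _)) (-‿cong (alternate-*ʳ k a b))

  alternate-comm : ∀ j k a → alt j (alt k a) ≈ alt k (alt j a)
  alternate-comm zero    k a = refl
  alternate-comm (suc j) k a = trans (-‿cong (alternate-comm j k a)) (neg k (alt j a))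
    where
    neg : ∀ k a → - alt k a ≈ alt k (- a)
    neg zero    a = refl
    neg (suc k) a = -‿cong (neg k a)

  -- The first alternative is the conclusion sought for the degree of g; the second is the sign rule
  -- that leads to a contradiction.
  alternate-parity : ∀ k → (∃ λ j → k ≡ 2 ℕ.* j) ⊎ (∀ a → alt k a ≈ - a)
  alternate-parity zero          = inj₁ (0 , ≡.refl)
  alternate-parity (suc zero)    = inj₂ λ _ → refl
  alternate-parity (suc (suc k)) with alternate-parity k
  ... | inj₁ (j , ≡.refl) = inj₁ (suc j , ≡.sym (ℕ.*-suc 2 j))
  ... | inj₂ alternates   = inj₂ λ a → trans (-‿involutive _) (alternates a)

  private
    TransposeInvariant : ℕ → Set
    TransposeInvariant n = ∀ (A : Matrix n) → d (A ᵀ) ≈ d A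

    minor₂ : ∀ {n} → Fin (suc n) → Fin (suc n) → Matrix (suc (suc n)) → Matrix n
    minor₂ i j A = minor i j (minor zero zero A)

    -- Up to sign, the contribution to `d A` of the permutations that use both the entry (0, j+1)
    -- and the entry (i+1, 0). The missing factor -1 comes from the column index being j+1 rather
    -- than j.
    term : ∀ {n} → Matrix (suc (suc n)) → Fin (suc n) → Fin (suc n) → Carrier
    term A j i =
      alt (toℕ j) (alt (toℕ i) (A zero (suc j) * (A (suc i) zero * d (minor₂ i j A))))

  -- The first row of A is expanded by definition, the first column of the minor
  -- because the minor has the same determinant as its transpose.
  row-column-expansion : ∀ {n} → TransposeInvariant (suc n) → TransposeInvariant n →
    ∀ (A : Matrix (suc (suc n))) →
    sum (λ j → - alt (toℕ j) (A zero (suc j) * d (minor zero (suc j) A))) ≈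
    sum (λ j → sum (λ i → - term A j i))
  row-column-expansion ih₁ ih₀ A = sum-cong-≋ λ j →
    let column = λ i → A (suc i) zero * d (minor₂ i j A) in begin
    - alt (toℕ j) (A zero (suc j) * d (minor zero (suc j) A))
      ≈⟨ alternate-cong (suc (toℕ j)) (*-congˡ (sym (ih₁ (minor zero (suc j) A)))) ⟩
    - alt (toℕ j) (A zero (suc j) * d (minor zero (suc j) A ᵀ))
      ≈⟨ alternate-cong (suc (toℕ j)) (*-congˡ (sum-cong-≋ λ i →
           alternate-cong (toℕ i) (*-congˡ {x = A (suc i) zero} (ih₀ (minor₂ i j A))))) ⟩
    - alt (toℕ j) (A zero (suc j) * sum (λ i → alt (toℕ i) (column i)))
      ≈⟨ alternate-cong (suc (toℕ j)) (*-distribˡ-sum (A zero (suc j)) (λ i → alt (toℕ i) (column i))) ⟩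
    - alt (toℕ j) (sum (λ i → A zero (suc j) * alt (toℕ i) (column i)))
      ≈⟨ alternate-sum (suc (toℕ j)) (λ i → A zero (suc j) * alt (toℕ i) (column i)) ⟩
    sum (λ i → - alt (toℕ j) (A zero (suc j) * alt (toℕ i) (column i)))
      ≈⟨ sum-cong-≋ (λ i → alternate-cong (suc (toℕ j)) (alternate-*ʳ (toℕ i) (A zero (suc j)) (column i))) ⟩
    sum (λ i → - term A j i) ∎

  -- Induction over two sizes. The entry (0, 0) contributes a minor of size n+1, settled by the
  -- induction hypothesis. The rest is a double sum over a column j+1 of the first row and a row i+1
  -- of the first column; transposition exchanges the two indices, so the order of summation is
  -- exchanged as well.
  det-transpose : ∀ {n} → TransposeInvariant n
  det-transpose {zero}        A = refl
  det-transpose {suc zero}    A = refl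
  det-transpose {suc (suc n)} A = +-cong (*-congˡ (det-transpose {suc n} (minor zero zero A))) (begin
    sum (λ j → - alt (toℕ j) (A (suc j) zero * d (minor zero (suc j) (A ᵀ))))
      ≈⟨ row-column-expansion (det-transpose {suc n}) (det-transpose {n}) (A ᵀ) ⟩
    sum (λ j → sum (λ i → - term (A ᵀ) j i))
      ≈⟨ ∑-comm (λ j i → - term (A ᵀ) j i) ⟩
    sum (λ i → sum (λ j → - term (A ᵀ) j i))
      ≈⟨ sum-cong-≋ (λ i → sum-cong-≋ (λ j → -‿cong (term-symmetric i j))) ⟩
    sum (λ i → sum (λ j → - term A i j))
      ≈⟨ row-column-expansion (det-transpose {suc n}) (det-transpose {n}) A ⟨
    sum (λ i → - alt (toℕ i) (A zero (suc i) * d (minor zero (suc i) A))) ∎)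
    where
    term-symmetric : ∀ i j → term (A ᵀ) j i ≈ term A i j
    term-symmetric i j = trans (alternate-comm (toℕ j) (toℕ i) _)
      (alternate-cong (toℕ i) (alternate-cong (toℕ j)
        (trans (x∙yz≈y∙xz _ _ _) (*-congˡ (*-congˡ (det-transpose {n} (minor₂ j i A)))))))

-- Power series and their truncations

module PowerSeries (K : CommutativeRing 0ℓ 0ℓ) where
  private
    module K = CommutativeRing K
    open K using (Carrier; _≈_)
    open CommutativeSemigroupProperties K.+-commutativeSemigroup using (interchange; x∙yz≈y∙xz)

  open RawRing (powerSeries K.rawRing) using (_+_; _*_; -_; 0#; 1#) public
  open SetoidReasoning K.setoid

  Series : Set
  Series = ℕ → Carrier

  const : Carrier → Series
  const = constant K.rawRing

  shift : Series → Series
  shift f zero    = K.0#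
  shift f (suc n) = f n

  infix 4 _≐_
  _≐_ : Series → Series → Set
  f ≐ g = ∀ n → f n ≈ g n

  -- The bound on the indices is what makes multiplication well defined modulo T^D.
  *-cong-≤ : ∀ n {f f′ g g′} → (∀ i → i ℕ.≤ n → f i ≈ f′ i) → (∀ i → i ℕ.≤ n → g i ≈ g′ i) →
             (f * g) n ≈ (f′ * g′) n
  *-cong-≤ zero    p q = K.+-congʳ (K.*-cong (p 0 z≤n) (q 0 z≤n))
  *-cong-≤ (suc n) p q = K.+-cong (K.*-cong (p 0 z≤n) (q (suc n) ℕ.≤-refl))
    (*-cong-≤ n (λ i i≤n → p (suc i) (s≤s i≤n)) (λ i i≤n → q i (ℕ.m≤n⇒m≤1+n i≤n)))

  *-distribʳ-+ : ∀ f g h → (g + h) * f ≐ g * f + h * f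
  *-distribʳ-+ f g h zero    = begin
    (g 0 K.+ h 0) K.* f 0 K.+ K.0#                 ≈⟨ K.+-identityʳ _ ⟩
    (g 0 K.+ h 0) K.* f 0                          ≈⟨ K.distribʳ (f 0) (g 0) (h 0) ⟩
    g 0 K.* f 0 K.+ h 0 K.* f 0                    ≈⟨ K.+-cong (K.+-identityʳ _) (K.+-identityʳ _) ⟨
    (g 0 K.* f 0 K.+ K.0#) K.+ (h 0 K.* f 0 K.+ K.0#)  ∎
  *-distribʳ-+ f g h (suc n) = K.trans
    (K.+-cong (K.distribʳ (f (suc n)) (g 0) (h 0)) (*-distribʳ-+ f (g ∘ suc) (h ∘ suc) n))
    (interchange _ _ _ _)

  -- By definition the convolution unfolds along its first factor. Unfolding along the second as
  -- well turns commutativity into an induction.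
  *-sucʳ : ∀ f g n → (f * g) (suc n) ≈ f (suc n) K.* g 0 K.+ (f * (g ∘ suc)) n
  *-sucʳ f g zero    = begin
    f 0 K.* g 1 K.+ (f 1 K.* g 0 K.+ K.0#)  ≈⟨ x∙yz≈y∙xz _ _ _ ⟩
    f 1 K.* g 0 K.+ (f 0 K.* g 1 K.+ K.0#)  ∎
  *-sucʳ f g (suc n) = K.trans (K.+-congˡ (*-sucʳ (f ∘ suc) g n)) (x∙yz≈y∙xz _ _ _)

  *-comm : ∀ f g → f * g ≐ g * f
  *-comm f g zero    = K.+-congʳ (K.*-comm (f 0) (g 0))
  *-comm f g (suc n) = K.trans (*-sucʳ f g n)
    (K.+-cong (K.*-comm (f (suc n)) (g 0)) (*-comm f (g ∘ suc) n))

  *-scaleˡ : ∀ a f g n → ((λ i → a K.* f i) * g) n ≈ a K.* (f * g) n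
  *-scaleˡ a f g zero    = begin
    a K.* f 0 K.* g 0 K.+ K.0#    ≈⟨ K.+-cong (K.*-assoc a (f 0) (g 0)) (K.sym (K.zeroʳ a)) ⟩
    a K.* (f 0 K.* g 0) K.+ a K.* K.0#  ≈⟨ K.distribˡ a _ _ ⟨
    a K.* (f 0 K.* g 0 K.+ K.0#)  ∎
  *-scaleˡ a f g (suc n) = K.trans
    (K.+-cong (K.*-assoc a (f 0) (g (suc n))) (*-scaleˡ a (f ∘ suc) g n))
    (K.sym (K.distribˡ a _ _))

  *-assoc : ∀ f g h → (f * g) * h ≐ f * (g * h)
  *-assoc f g h zero    = begin
    (f 0 K.* g 0 K.+ K.0#) K.* h 0 K.+ K.0#  ≈⟨ K.+-congʳ (K.*-congʳ (K.+-identityʳ _)) ⟩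
    f 0 K.* g 0 K.* h 0 K.+ K.0#             ≈⟨ K.+-congʳ (K.*-assoc (f 0) (g 0) (h 0)) ⟩
    f 0 K.* (g 0 K.* h 0) K.+ K.0#           ≈⟨ K.+-congʳ (K.*-congˡ (K.+-identityʳ _)) ⟨
    f 0 K.* (g 0 K.* h 0 K.+ K.0#) K.+ K.0#  ∎
  *-assoc f g h (suc n) = begin
    (f 0 K.* g 0 K.+ K.0#) K.* h (suc n) K.+ (((λ i → f 0 K.* g (suc i)) + f ∘ suc * g) * h) n
      ≈⟨ K.+-cong (K.trans (K.*-congʳ (K.+-identityʳ _)) (K.*-assoc (f 0) (g 0) (h (suc n))))
                  (K.trans (*-distribʳ-+ h (λ i → f 0 K.* g (suc i)) (f ∘ suc * g) n)
                           (K.+-cong (*-scaleˡ (f 0) (g ∘ suc) h n) (*-assoc (f ∘ suc) g h n))) ⟩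
    f 0 K.* (g 0 K.* h (suc n)) K.+ (f 0 K.* (g ∘ suc * h) n K.+ (f ∘ suc * (g * h)) n)
      ≈⟨ K.+-assoc _ _ _ ⟨
    (f 0 K.* (g 0 K.* h (suc n)) K.+ f 0 K.* (g ∘ suc * h) n) K.+ (f ∘ suc * (g * h)) n
      ≈⟨ K.+-congʳ (K.distribˡ (f 0) _ _) ⟨
    f 0 K.* (g * h) (suc n) K.+ (f ∘ suc * (g * h)) n ∎

  0-* : ∀ f n → ((λ _ → K.0#) * f) n ≈ K.0#
  0-* f zero    = K.trans (K.+-identityʳ _) (K.zeroˡ _)
  0-* f (suc n) = K.trans (K.+-cong (K.zeroˡ _) (0-* f n)) (K.+-identityʳ _)

  const-* : ∀ a f n → (const a * f) n ≈ a K.* f n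
  const-* a f zero    = K.+-identityʳ _
  const-* a f (suc n) = K.trans (K.+-congˡ (0-* f n)) (K.+-identityʳ _)

  shift-* : ∀ f g → shift f * g ≐ shift (f * g)
  shift-* f g zero    = K.trans (K.+-identityʳ _) (K.zeroˡ _)
  shift-* f g (suc n) = K.trans (K.+-congʳ (K.zeroˡ _)) (K.+-identityˡ _)

  -- K[[T]]/(T^D)
  truncated : ℕ → CommutativeRing 0ℓ 0ℓ
  truncated D = record
    { Carrier = Series
    ; _≈_ = λ f g → ∀ n → n ℕ.< D → f n ≈ g n
    ; _+_ = _+_
    ; _*_ = _*_
    ; -_  = -_
    ; 0#  = 0#
    ; 1#  = 1#
    ; isCommutativeRing = record
      { isRing = record
        { +-isAbelianGroup = record
          { isGroup = record
            { isMonoid = record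
              { isSemigroup = record
                { isMagma = record
                  { isEquivalence = record
                    { refl  = λ _ _ → K.refl
                    ; sym   = λ p n n<D → K.sym (p n n<D)
                    ; trans = λ p q n n<D → K.trans (p n n<D) (q n n<D)
                    }
                  ; ∙-cong = λ p q n n<D → K.+-cong (p n n<D) (q n n<D)
                  }
                ; assoc = λ f g h n _ → K.+-assoc (f n) (g n) (h n)
                }
              ; identity = (λ f n _ → +-identityˡ f n)
                         , (λ f n _ → K.trans (K.+-comm _ _) (+-identityˡ f n))
              }
            ; inverse = (λ f n _ → +-inverseˡ f n)
                      , (λ f n _ → K.trans (K.+-comm _ _) (+-inverseˡ f n))
            ; ⁻¹-cong = λ p n n<D → K.-‿cong (p n n<D)
            }
          ; comm = λ f g n _ → K.+-comm (f n) (g n)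
          }
        ; *-cong = λ p q n n<D → *-cong-≤ n (λ i i≤n → p i (ℕ.≤-<-trans i≤n n<D))
                                            (λ i i≤n → q i (ℕ.≤-<-trans i≤n n<D))
        ; *-assoc = λ f g h n _ → *-assoc f g h n
        ; *-identity = (λ f n _ → *-identityˡ f n)
                     , (λ f n _ → K.trans (*-comm f 1# n) (*-identityˡ f n))
        ; distrib = (λ f g h n _ → K.trans (*-comm f (g + h) n) (K.trans (*-distribʳ-+ f g h n)
                                     (K.+-cong (*-comm g f n) (*-comm h f n))))
                  , (λ f g h n _ → *-distribʳ-+ f g h n)
        }
      ; *-comm = λ f g n _ → *-comm f g n
      }
    }
    where
    const-0 : ∀ n → 0# n ≈ K.0#
    const-0 zero    = K.refl
    const-0 (suc n) = K.refl
    +-identityˡ : ∀ f → 0# + f ≐ f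
    +-identityˡ f n = K.trans (K.+-congʳ (const-0 n)) (K.+-identityˡ (f n))
    +-inverseˡ : ∀ f → - f + f ≐ 0#
    +-inverseˡ f n = K.trans (K.-‿inverseˡ (f n)) (K.sym (const-0 n))
    *-identityˡ : ∀ f → 1# * f ≐ f
    *-identityˡ f n = K.trans (const-* K.1# f n) (K.*-identityˡ (f n))

  -- Up to degree `e`, every term of the convolution except `f e K.* g 0` contains a coefficient of
  -- `f` below `e`.
  leading-* : ∀ e f g → (∀ n → n ℕ.< e → f n ≈ K.0#) →
              (∀ n → n ℕ.< e → (f * g) n ≈ K.0#) × (f * g) e ≈ f e K.* g 0
  leading-* zero    f g f≈0 = (λ _ ()) , K.+-identityʳ _
  leading-* (suc e) f g f≈0 = low , K.trans (f₀*g≈0 (suc e)) (proj₂ tail)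
    where
    tail = leading-* e (f ∘ suc) g (λ n n<e → f≈0 (suc n) (s≤s n<e))
    f₀*g≈0 : ∀ k {a} → f 0 K.* g k K.+ a ≈ a
    f₀*g≈0 k = K.trans (K.+-congʳ (K.trans (K.*-congʳ (f≈0 0 ℕ.z<s)) (K.zeroˡ _))) (K.+-identityˡ _)
    low : ∀ n → n ℕ.< suc e → (f * g) n ≈ K.0#
    low zero    _         = f₀*g≈0 0
    low (suc n) (s≤s n<e) = K.trans (f₀*g≈0 (suc n)) (proj₁ tail n n<e)

-- Substitution as a relation between polynomial values

module HornerSubstitution
  (K R : CommutativeRing 0ℓ 0ℓ)
  (κ : CommutativeRing.Carrier K → CommutativeRing.Carrier R)
  (κ-isRingHomomorphism :
    RingMorphisms.IsRingHomomorphism (CommutativeRing.rawRing K) (CommutativeRing.rawRing R) κ)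
  (T S : CommutativeRing.Carrier R) where
  open CommutativeRing R hiding (zero)
  private
    module K = CommutativeRing K
    module κ = RingMorphisms.IsRingHomomorphism κ-isRingHomomorphism
  open RingProperties ring using (-‿distribʳ-*; -‿+-comm; -0#≈0#)
  open CommutativeSemigroupProperties +-commutativeSemigroup using (interchange)
  open CommutativeSemigroupProperties *-commutativeSemigroup using (x∙yz≈y∙xz)
  open Exp semiring using (^-homo-*; ^-congˡ) renaming (_^_ to _^ˢ_)
  open CommutativeExp commutativeSemiring using (^-distrib-*)
  open SetoidReasoning setoid

  -- f ~ g exhibits a polynomial p over K in Horner form with f = p(T) and g = p(S).
  infix 4 _~_
  data _~_ (f g : Carrier) : Set where
    null   : f ≈ 0# → g ≈ 0# → f ~ g
    horner : ∀ c {f′ g′} → f′ ~ g′ → f ≈ κ c + T * f′ → g ≈ κ c + S * g′ → f ~ g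

  ~-resp-≈ : ∀ {f g f′ g′} → f ≈ f′ → g ≈ g′ → f ~ g → f′ ~ g′
  ~-resp-≈ p q (null r s)       = null (trans (sym p) r) (trans (sym q) s)
  ~-resp-≈ p q (horner c h r s) = horner c h (trans (sym p) r) (trans (sym q) s)

  ~-κ : ∀ a → κ a ~ κ a
  ~-κ a = horner a (null refl refl) (lem T) (lem S)
    where lem : ∀ t → κ a ≈ κ a + t * 0#
          lem t = sym (trans (+-congˡ (zeroʳ t)) (+-identityʳ _))

  ~-T* : ∀ {f g} → f ~ g → T * f ~ S * g
  ~-T* h = horner K.0# h (lem T) (lem S)
    where lem : ∀ t {f} → t * f ≈ κ K.0# + t * f
          lem t = sym (trans (+-congʳ κ.0#-homo) (+-identityˡ _))

  ~-+ : ∀ {f g f′ g′} → f ~ g → f′ ~ g′ → f + f′ ~ g + g′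
  ~-+ (null p q) h = ~-resp-≈ (sym (lem p)) (sym (lem q)) h
    where lem : ∀ {f h} → f ≈ 0# → f + h ≈ h
          lem p = trans (+-congʳ p) (+-identityˡ _)
  ~-+ h@(horner _ _ _ _) (null p q) = ~-resp-≈ (sym (lem p)) (sym (lem q)) h
    where lem : ∀ {f h} → f ≈ 0# → h + f ≈ h
          lem p = trans (+-congˡ p) (+-identityʳ _)
  ~-+ (horner a h p q) (horner b h′ p′ q′) = horner (a K.+ b) (~-+ h h′) (lem T p p′) (lem S q q′)
    where
    lem : ∀ t {f g f′ g′} → f ≈ κ a + t * f′ → g ≈ κ b + t * g′ →
          f + g ≈ κ (a K.+ b) + t * (f′ + g′)
    lem t p q = trans (+-cong p q) (trans (interchange _ _ _ _)
      (+-cong (sym (κ.+-homo a b)) (sym (distribˡ t _ _))))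

  ~-neg : ∀ {f g} → f ~ g → - f ~ - g
  ~-neg (null p q) = null (trans (-‿cong p) -0#≈0#) (trans (-‿cong q) -0#≈0#)
  ~-neg (horner a h p q) = horner (K.- a) (~-neg h) (lem T p) (lem S q)
    where
    lem : ∀ t {f f′} → f ≈ κ a + t * f′ → - f ≈ κ (K.- a) + t * (- f′)
    lem t p = trans (-‿cong p) (trans (sym (-‿+-comm _ _))
      (+-cong (sym (κ.-‿homo a)) (-‿distribʳ-* t _)))

  ~-scale : ∀ a {f g} → f ~ g → κ a * f ~ κ a * g
  ~-scale a (null p q) = null (trans (*-congˡ p) (zeroʳ _)) (trans (*-congˡ q) (zeroʳ _))
  ~-scale a (horner b h p q) = horner (a K.* b) (~-scale a h) (lem T p) (lem S q)
    where
    lem : ∀ t {f f′} → f ≈ κ b + t * f′ → κ a * f ≈ κ (a K.* b) + t * (κ a * f′)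
    lem t p = trans (*-congˡ p) (trans (distribˡ _ _ _)
      (+-cong (sym (κ.*-homo a b)) (x∙yz≈y∙xz _ _ _)))

  ~-* : ∀ {f g f′ g′} → f ~ g → f′ ~ g′ → f * f′ ~ g * g′
  ~-* (null p q) h = null (trans (*-congʳ p) (zeroˡ _)) (trans (*-congʳ q) (zeroˡ _))
  ~-* (horner a h p q) h′ =
    ~-resp-≈ (sym (lem T p)) (sym (lem S q)) (~-+ (~-scale a h′) (~-T* (~-* h h′)))
    where
    lem : ∀ t {f f′ g} → f ≈ κ a + t * f′ → f * g ≈ κ a * g + t * (f′ * g)
    lem t p = trans (*-congʳ p) (trans (distribʳ _ _ _) (+-congˡ (*-assoc _ _ _)))

  ~-1 : 1# ~ 1#
  ~-1 = ~-resp-≈ κ.1#-homo κ.1#-homo (~-κ K.1#)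

  ~-^ : ∀ {f g} → f ~ g → ∀ n → f ^ˢ n ~ g ^ˢ n
  ~-^ f~g zero    = ~-1
  ~-^ f~g (suc n) = ~-* f~g (~-^ f~g n)

  -- If xᵃ⁺ᵇ = 1 then y = x⁻¹ gives yᵃ = xᵇ.
  ~-inverse-^ : ∀ {x y} → x ~ y → x * y ≈ 1# → ∀ a b → x ^ˢ (a ℕ.+ b) ≈ 1# → x ^ˢ a ~ x ^ˢ b
  ~-inverse-^ {x} {y} x~y xy≈1 a b x^[a+b]≈1 = ~-resp-≈ refl (begin
    y ^ˢ a                      ≈⟨ *-identityʳ _ ⟨
    y ^ˢ a * 1#                 ≈⟨ *-congˡ x^[a+b]≈1 ⟨
    y ^ˢ a * x ^ˢ (a ℕ.+ b)     ≈⟨ *-congˡ (^-homo-* x a b) ⟩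
    y ^ˢ a * (x ^ˢ a * x ^ˢ b)  ≈⟨ *-assoc _ _ _ ⟨
    y ^ˢ a * x ^ˢ a * x ^ˢ b    ≈⟨ *-congʳ (^-distrib-* y x a) ⟨
    (y * x) ^ˢ a * x ^ˢ b       ≈⟨ *-congʳ (^-congˡ a (trans (*-comm y x) xy≈1)) ⟩
    1# ^ˢ a * x ^ˢ b            ≈⟨ *-congʳ (1^n≈1 a) ⟩
    1# * x ^ˢ b                 ≈⟨ *-identityˡ _ ⟩
    x ^ˢ b                      ∎) (~-^ x~y a)
    where
    1^n≈1 : ∀ n → 1# ^ˢ n ≈ 1#
    1^n≈1 zero    = refl
    1^n≈1 (suc n) = trans (*-identityˡ _) (1^n≈1 n)

-- The substitution of (1+T)⁻¹ - 1 for T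

module Involution (K : CommutativeRing 0ℓ 0ℓ) (D : ℕ) where
  private
    module K = CommutativeRing K
    module KP = RingProperties K.ring
  open PowerSeries K using (Series; const; shift; const-*; shift-*; leading-*; truncated)
  open CommutativeRing (truncated D) hiding (zero)
  open RingProperties ring using (-‿distribˡ-*)

  private
    alt : ℕ → K.Carrier → K.Carrier
    alt = alternate K.rawRing

  -- The inverse is the geometric series 1 - T + T² - ⋯. `S` is written as -T(1+T)⁻¹, so that its
  -- factor T and its sign are explicit.
  T [1+T] [1+T]⁻¹ S : Series
  T       = shift 1#
  [1+T]   = 1# + T
  [1+T]⁻¹ = λ n → alt n K.1#
  S       = - shift [1+T]⁻¹

  const-isRingHomomorphism : RingMorphisms.IsRingHomomorphism K.rawRing rawRing const
  const-isRingHomomorphism = record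
    { isSemiringHomomorphism = record
      { isNearSemiringHomomorphism = record
        { +-isMonoidHomomorphism = record
          { isMagmaHomomorphism = record
            { isRelHomomorphism = record { cong = const-cong }
            ; homo = const-+
            }
          ; ε-homo = λ _ _ → K.refl
          }
        ; *-homo = const-*-const
        }
      ; 1#-homo = λ _ _ → K.refl
      }
    ; -‿homo = const-neg
    }
    where
    const-cong : ∀ {a b} → a K.≈ b → const a ≈ const b
    const-cong a≈b zero    _ = a≈b
    const-cong a≈b (suc n) _ = K.refl
    const-+ : ∀ a b → const (a K.+ b) ≈ const a + const b
    const-+ a b zero    _ = K.refl
    const-+ a b (suc n) _ = K.sym (K.+-identityˡ K.0#)
    const-neg : ∀ a → const (K.- a) ≈ - const a
    const-neg a zero    _ = K.refl
    const-neg a (suc n) _ = K.sym KP.-0#≈0#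
    const-*-const : ∀ a b → const (a K.* b) ≈ const a * const b
    const-*-const a b zero    _ = K.sym (const-* a (const b) 0)
    const-*-const a b (suc n) _ = K.sym (K.trans (const-* a (const b) (suc n)) (K.zeroʳ a))

  open HornerSubstitution K (truncated D) const const-isRingHomomorphism T S public

  T*≈shift : ∀ f → T * f ≈ shift f
  T*≈shift f zero    _ = shift-* 1# f zero
  T*≈shift f (suc n) _ = K.trans (shift-* 1# f (suc n)) (K.trans (const-* K.1# f n) (K.*-identityˡ (f n)))

  -- The product is commuted so that `g` comes first, the factor whose vanishing coefficients
  -- `leading-*` tracks.
  S*≈ : ∀ g → S * g ≈ - shift (g * [1+T]⁻¹)
  S*≈ g = trans (sym (-‿distribˡ-* (shift [1+T]⁻¹) g)) (-‿cong λ n n<D →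
    K.trans (shift-* [1+T]⁻¹ g n) (shift-cong n n<D))
    where shift-cong : shift ([1+T]⁻¹ * g) ≈ shift (g * [1+T]⁻¹)
          shift-cong zero    _   = K.refl
          shift-cong (suc n) n<D = *-comm [1+T]⁻¹ g n (ℕ.<-trans (ℕ.n<1+n n) n<D)

  -- The sign comes from S = -T + T² - ⋯.
  ~-leading : ∀ {f g} → f ~ g → ∀ e → e ℕ.< D → (∀ n → n ℕ.< e → f n K.≈ K.0#) →
              (∀ n → n ℕ.< e → g n K.≈ K.0#) × g e K.≈ alt e (f e)
  ~-leading (null p q) e e<D f≈0 =
    (λ n n<e → K.trans (q n (ℕ.<-trans n<e e<D)) (0#≈0 n)) ,
    K.trans (K.trans (q e e<D) (0#≈0 e)) (K.sym (alt-0 e (K.trans (p e e<D) (0#≈0 e))))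
    where
    0#≈0 : ∀ n → 0# n K.≈ K.0#
    0#≈0 zero    = K.refl
    0#≈0 (suc n) = K.refl
    alt-0 : ∀ k {a} → a K.≈ K.0# → alt k a K.≈ K.0#
    alt-0 zero    a≈0 = a≈0
    alt-0 (suc k) a≈0 = K.trans (K.-‿cong (alt-0 k a≈0)) KP.-0#≈0#
  ~-leading {f} {g} (horner c {f′} {g′} h p q) e e<D f≈0 = go e e<D f≈0
    where
    f₀≈c : 0 ℕ.< D → f 0 K.≈ c
    f₀≈c 0<D = K.trans (p 0 0<D) (K.trans (K.+-congˡ (T*≈shift f′ 0 0<D)) (K.+-identityʳ c))
    g₀≈c : 0 ℕ.< D → g 0 K.≈ c
    g₀≈c 0<D = K.trans (q 0 0<D) (K.trans (K.+-congˡ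
      (K.trans (S*≈ g′ 0 0<D) KP.-0#≈0#)) (K.+-identityʳ c))
    f≈f′ : ∀ n → suc n ℕ.< D → f (suc n) K.≈ f′ n
    f≈f′ n n<D = K.trans (p (suc n) n<D) (K.trans (K.+-identityˡ _) (T*≈shift f′ (suc n) n<D))
    g≈g′ : ∀ n → suc n ℕ.< D → g (suc n) K.≈ K.- (g′ * [1+T]⁻¹) n
    g≈g′ n n<D = K.trans (q (suc n) n<D) (K.trans (K.+-identityˡ _) (S*≈ g′ (suc n) n<D))
    go : ∀ e → e ℕ.< D → (∀ n → n ℕ.< e → f n K.≈ K.0#) →
         (∀ n → n ℕ.< e → g n K.≈ K.0#) × g e K.≈ alt e (f e)
    go zero    0<D f≈0 = (λ _ ()) , K.trans (g₀≈c 0<D) (K.sym (f₀≈c 0<D))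
    -- Beyond the constant term, `f` is T f′ and `g` is -T(g′(1+T)⁻¹). Removing T lowers the degree
    -- by one and costs one sign; the factor (1+T)⁻¹ has constant term 1 and leaves the leading
    -- coefficient alone.
    go (suc e) e<D f≈0 = low , K.trans (g≈g′ e e<D) (K.-‿cong (K.trans (proj₂ prod)
      (K.trans (K.*-identityʳ (g′ e)) (K.trans (proj₂ ih) (alt-cong e (K.sym (f≈f′ e e<D)))))))
      where
      0<D : 0 ℕ.< D
      0<D = ℕ.<-trans ℕ.z<s e<D
      ih = ~-leading h e (ℕ.<-trans (ℕ.n<1+n e) e<D)
        (λ n n<e → K.trans (K.sym (f≈f′ n (ℕ.<-trans (s≤s n<e) e<D))) (f≈0 (suc n) (s≤s n<e)))
      prod = leading-* e g′ [1+T]⁻¹ (proj₁ ih)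
      alt-cong = IsRingRelation.alternate-rel (Determinant.cong-isRingRelation K)
      low : ∀ n → n ℕ.< suc e → g n K.≈ K.0#
      low zero    _         = K.trans (g₀≈c 0<D) (K.trans (K.sym (f₀≈c 0<D)) (f≈0 0 ℕ.z<s))
      low (suc n) (s≤s n<e) = K.trans (g≈g′ n (ℕ.<-trans (s≤s n<e) e<D))
        (K.trans (K.-‿cong (proj₁ prod n n<e)) KP.-0#≈0#)

  [1+T]-inverse : [1+T] * [1+T]⁻¹ ≈ 1#
  [1+T]-inverse = trans (distribʳ [1+T]⁻¹ 1# T)
    (trans (+-cong (*-identityˡ _) (T*≈shift _)) cancel)
    where
    cancel : [1+T]⁻¹ + shift [1+T]⁻¹ ≈ 1#
    cancel zero    _ = K.+-identityʳ K.1#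
    cancel (suc n) _ = K.-‿inverseˡ _

  -- The polynomial is 1+X, since 1+S = (1+T)⁻¹.
  [1+T]~[1+T]⁻¹ : [1+T] ~ [1+T]⁻¹
  [1+T]~[1+T]⁻¹ = horner K.1# (~-κ K.1#)
    (+-congˡ (sym (*-identityʳ T))) (trans y≈1+S (+-congˡ (sym (*-identityʳ S))))
    where
    y≈1+S : [1+T]⁻¹ ≈ 1# + S
    y≈1+S zero    _ = K.sym (K.trans (K.+-congˡ KP.-0#≈0#) (K.+-identityʳ K.1#))
    y≈1+S (suc n) _ = K.sym (K.+-identityˡ _)

-- Integers modulo powers of ℓ

module Residues (ℓ : ℕ) (ℓ-prime : Prime ℓ) where
  open ℓ-adic ℓ ℓ-prime

  ℤmod : ℕ → CommutativeRing 0ℓ 0ℓ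
  ℤmod N = record
    { Carrier = ℤ
    ; _≈_ = _≡_mod-ℓ^ N
    ; _+_ = ℤ._+_
    ; _*_ = ℤ._*_
    ; -_  = ℤ.-_
    ; 0#  = 0ℤ
    ; 1#  = 1ℤ
    ; isCommutativeRing = record
      { isRing = record
        { +-isAbelianGroup = record
          { isGroup = record
            { isMonoid = record
              { isSemigroup = record
                { isMagma = record
                  { isEquivalence = record
                    { refl = ≡ᵐ-reflexive ≡.refl ; sym = ≡ᵐ-sym ; trans = ≡ᵐ-trans }
                  ; ∙-cong = ≡ᵐ-+
                  }
                ; assoc = λ a b c → ≡ᵐ-reflexive (ℤ.+-assoc a b c)
                }
              ; identity = (λ a → ≡ᵐ-reflexive (ℤ.+-identityˡ a))
                         , (λ a → ≡ᵐ-reflexive (ℤ.+-identityʳ a))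
              }
            ; inverse = (λ a → ≡ᵐ-reflexive (ℤ.+-inverseˡ a))
                      , (λ a → ≡ᵐ-reflexive (ℤ.+-inverseʳ a))
            ; ⁻¹-cong = ≡ᵐ-neg
            }
          ; comm = λ a b → ≡ᵐ-reflexive (ℤ.+-comm a b)
          }
        ; *-cong = ≡ᵐ-*
        ; *-assoc = λ a b c → ≡ᵐ-reflexive (ℤ.*-assoc a b c)
        ; *-identity = (λ a → ≡ᵐ-reflexive (ℤ.*-identityˡ a))
                     , (λ a → ≡ᵐ-reflexive (ℤ.*-identityʳ a))
        ; distrib = (λ a b c → ≡ᵐ-reflexive (ℤ.*-distribˡ-+ a b c))
                  , (λ a b c → ≡ᵐ-reflexive (ℤ.*-distribʳ-+ a b c))
        }
      ; *-comm = λ a b → ≡ᵐ-reflexive (ℤ.*-comm a b)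
      }
    }

  -- Multiplied by n!, the binomial coefficient becomes a falling factorial, an integer polynomial
  -- that respects congruences. Dividing by n! again loses fewer than n! powers of ℓ, which the
  -- surplus in the exponent covers.
  C-cong : ∀ k n {a b} → + a ≡ + b mod-ℓ^ (k ℕ.+ n !) → + (a C n) ≡ + (b C n) mod-ℓ^ k
  C-cong k n {a} {b} a≡b = ≡-mod (ℤ.∣ᵤ⇒∣ (divide-out k (n !) ℤ.∣ + (a C n) ℤ.- + (b C n) ∣ {{n ℕ.!≢0}}
    (≡.subst (ℓ ^ (k ℕ.+ n !) ℕ.∣_) (ℤ.abs-* (+ (n !)) (+ (a C n) ℤ.- + (b C n))) (ℤ.∣⇒∣ᵤ n!-multiple))))
    where
    factor : ∀ f c c′ → f ℤ.* c ℤ.- f ℤ.* c′ ≡ f ℤ.* (c ℤ.- c′)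
    factor = solve-∀
    n!-multiple : + (ℓ ^ (k ℕ.+ n !)) ℤ.∣ + (n !) ℤ.* (+ (a C n) ℤ.- + (b C n))
    n!-multiple = ≡.subst (+ (ℓ ^ (k ℕ.+ n !)) ℤ.∣_)
      (≡.trans (≡.cong₂ ℤ._-_ (≡.sym (n!*C a n)) (≡.sym (n!*C b n))) (factor (+ (n !)) (+ (a C n)) (+ (b C n))))
      (ℓ^n∣a-b (fallingℤ-cong a≡b n))

  ≡ᵐ-weaken-≤ : ∀ {j k a b} → j ℕ.≤ k → a ≡ b mod-ℓ^ k → a ≡ b mod-ℓ^ j
  ≡ᵐ-weaken-≤ {j} {k} {a} {b} j≤k p =
    ≡ᵐ-weaken j (k ∸ j) (≡.subst (a ≡ b mod-ℓ^_) (≡.sym (ℕ.m+[n∸m]≡n j≤k)) p)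

  at-≤ : ∀ b {j k} → j ℕ.≤ k → at b k ≡ at b j mod-ℓ^ j
  at-≤ b {j} {k} j≤k =
    ≡.subst (λ i → at b i ≡ at b j mod-ℓ^ j) (ℕ.m+[n∸m]≡n j≤k) (at-+ b j (k ∸ j))

  -- Reduction of ℤ_ℓ[[T]] modulo ℓ^N and T^D

  module Reduction (N D : ℕ) where
    open PowerSeries (ℤmod N) using (Series; const; truncated; shift)
    open Involution (ℤmod N) D public
    open CommutativeRing (truncated D) using (_≈_; _+_; _*_; 1#; rawRing; semiring; setoid;
      distribʳ; *-identityˡ; +-cong; *-congˡ; +-comm) renaming (refl to ≈-refl; sym to ≈-sym; trans to ≈-trans)
    open Exp semiring using () renaming (_^_ to _^ˢ_)
    private module Z = RawRing ℤₗ[[T]]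

    reduction : (ℕ → ℤₗ) → Series
    reduction f n = at (f n) N

    reduction-scalar : ∀ z → reduction (scalar z) ≈ const z
    reduction-scalar z zero    _ = ≡ᵐ-reflexive ≡.refl
    reduction-scalar z (suc n) _ = ≡ᵐ-reflexive ≡.refl

    reduction-isRingRelation : IsRingRelation ℤₗ[[T]] rawRing (λ f g → reduction f ≈ g)
    reduction-isRingRelation = record
      { +-rel = λ p q n n<D → ≡ᵐ-+ (p n n<D) (q n n<D)
      ; *-rel = λ {f} {g} p q → ≈-trans
          (λ n _ → ≡ᵐ-reflexive (at-sum {suc n} (λ i → RawRing._*_ ℤₗ-rawRing (f (toℕ i)) (g (n ∸ toℕ i)))))
          (CommutativeRing.*-cong (truncated D) p q)
      ; -‿rel = λ p n n<D → ≡ᵐ-neg (p n n<D)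
      ; 0-rel = reduction-scalar 0ℤ
      ; 1-rel = reduction-scalar 1ℤ
      }
      where
      at-sum : ∀ {k} (a : Fin k → ℤₗ) → at (RawMonoidDefs.sum (RawRing.+-rawMonoid ℤₗ-rawRing) a) N
                 ≡ RawMonoidDefs.sum ℤ.+-0-rawMonoid (λ i → at (a i) N)
      at-sum {zero}  a = ≡.refl
      at-sum {suc k} a = ≡.cong (λ b → at (a zero) N ℤ.+ b) (at-sum (a ∘ suc))

    reduction-* : ∀ f g → reduction (f Z.* g) ≈ reduction f * reduction g
    reduction-* f g = IsRingRelation.*-rel reduction-isRingRelation {f} {g} ≈-refl ≈-refl

    infix 4 _≋_
    -- The record keeps `f` and `g` visible in the type: `reduction` computes through the ring
    -- operations, so they could not be read off from their reductions.
    record _≋_ (f g : Z.Carrier) : Set where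
      constructor ≋-intro
      field reduction-~ : reduction f ~ reduction g
    open _≋_ public

    ≋-scalar : ∀ z → scalar z ≋ scalar z
    ≋-scalar z = ≋-intro
      (~-resp-≈ (≈-sym (reduction-scalar z)) (≈-sym (reduction-scalar z)) (~-κ z))

    ≋-isRingRelation : IsRingRelation ℤₗ[[T]] ℤₗ[[T]] _≋_
    ≋-isRingRelation = record
      { +-rel = λ (≋-intro p) (≋-intro q) → ≋-intro (~-+ p q)
      ; *-rel = λ {f} {g} {f′} {g′} (≋-intro p) (≋-intro q) → ≋-intro
          (~-resp-≈ (≈-sym (reduction-* f g)) (≈-sym (reduction-* f′ g′)) (~-* p q))
      ; -‿rel = λ (≋-intro p) → ≋-intro (~-neg p)
      ; 0-rel = ≋-scalar 0ℤ
      ; 1-rel = ≋-scalar 1ℤ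
      }
    binomialSeries : ℕ → Series
    binomialSeries a n = + (a C n)

    binomialSeries-suc : ∀ a → binomialSeries (suc a) ≈ binomialSeries a + shift (binomialSeries a)
    binomialSeries-suc a zero    _ = ≡ᵐ-reflexive ≡.refl
    binomialSeries-suc a (suc n) _ = ≡ᵐ-reflexive (≡.trans
      (≡.cong +_ (≡.sym (≡.trans (ℕ.+-comm (a C suc n) (a C n)) (nCk+nC[k+1]≡[n+1]C[k+1] a n))))
      (ℤ.pos-+ (a C suc n) (a C n)))

    [1+T]^≈binomialSeries : ∀ a → [1+T] ^ˢ a ≈ binomialSeries a
    [1+T]^≈binomialSeries zero    zero    _ = ≡ᵐ-reflexive ≡.refl
    [1+T]^≈binomialSeries zero    (suc n) _ =
      ≡ᵐ-reflexive (≡.cong +_ (≡.sym (k>n⇒nCk≡0 {0} {suc n} ℕ.z<s)))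
    [1+T]^≈binomialSeries (suc a) = ≈-trans (*-congˡ {[1+T]} ([1+T]^≈binomialSeries a))
      (≈-trans (distribʳ (binomialSeries a) 1# T)
      (≈-trans (+-cong (*-identityˡ (binomialSeries a)) (T*≈shift (binomialSeries a)))
               (≈-sym (binomialSeries-suc a))))

    -- A modulus ℓ^precision determines the first D binomial coefficients modulo ℓ^N.
    precision : ℕ
    precision = N ℕ.+ D !

    ≤-precision : ∀ {n} → n ℕ.< D → N ℕ.+ n ! ℕ.≤ precision
    ≤-precision n<D = ℕ.+-monoʳ-≤ N (ℕ.∣⇒≤ {{D ℕ.!≢0}} (ℕ.m≤n⇒m!∣n! (ℕ.<⇒≤ n<D)))

    binomialSeries-cong : ∀ {a b} → + a ≡ + b mod-ℓ^ precision → binomialSeries a ≈ binomialSeries b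
    binomialSeries-cong a≡b n n<D = C-cong N n (≡ᵐ-weaken-≤ (≤-precision n<D) a≡b)

    -- In `[1+T]^ b` the n-th coefficient uses a residue whose modulus grows with n. At `precision`
    -- a single natural exponent serves all n < D.
    reduction-[1+T]^ : ∀ b → [1+T] ^ˢ residue b precision ≈ reduction ([1+T]^ b)
    reduction-[1+T]^ b = ≈-trans ([1+T]^≈binomialSeries (residue b precision)) λ n n<D →
      C-cong N n (≡ᵐ-trans (≡ᵐ-weaken-≤ (≤-precision n<D) (residue≡at b precision))
        (≡ᵐ-trans (at-≤ b (≤-precision n<D)) (≡ᵐ-sym (residue≡at b (N ℕ.+ n !)))))

    -- The symmetric hypothesis covers both passages, from α to -α and back. The two residues sum to
    -- 0 modulo ℓ^`precision`, so 1+T to the power of that sum is (1+T)^0 = 1, as `~-inverse-^`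
    -- requires.
    [1+T]^-≋ : ∀ a b → (∀ k → at a k ℤ.+ at b k ≡ 0ℤ) → ([1+T]^ a) ≋ ([1+T]^ b)
    [1+T]^-≋ a b a+b≡0 = ≋-intro (~-resp-≈ (reduction-[1+T]^ a) (reduction-[1+T]^ b)
      (~-inverse-^ [1+T]~[1+T]⁻¹ [1+T]-inverse (residue a precision) (residue b precision)
        (≈-trans ([1+T]^≈binomialSeries (residue a precision ℕ.+ residue b precision))
        (≈-trans (binomialSeries-cong sum≡0) (≈-sym ([1+T]^≈binomialSeries 0))))))
      where
      sum≡0 : + (residue a precision ℕ.+ residue b precision) ≡ + 0 mod-ℓ^ precision
      sum≡0 = ≡ᵐ-trans (≡ᵐ-reflexive (ℤ.pos-+ (residue a precision) (residue b precision)))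
        (≡ᵐ-trans (≡ᵐ-+ (residue≡at a precision) (residue≡at b precision))
                  (≡ᵐ-reflexive (a+b≡0 precision)))

    -- Invariance of the characteristic series

    module _ {u m : ℕ} (X : Multigraph (Fin u) (Fin m)) (sec : Multigraph.Section X)
             (α : Image.S sec → ℤₗ) where
      open Multigraph X
      open Image sec using (inS?)
      open Characteristic X sec α using (∑S; M; f)
      open IsRingRelation ≋-isRingRelation

      D-≋ : ∀ i j → Characteristic.D X sec α i j ≋ Characteristic.D X sec α j i
      D-≋ i j with i Fin.≟ j | j Fin.≟ i
      ... | yes ≡.refl | yes _      = ≋-scalar (+ valency X i)
      ... | yes ≡.refl | no  j≢j    = contradiction ≡.refl j≢j
      ... | no  i≢i    | yes ≡.refl = contradiction ≡.refl i≢i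
      ... | no  _      | no  _      = ≋-scalar 0ℤ

      -- The summands of ∑S are local to its definition, so that the type of
      -- ∑S-term-≋ has to be inferred from its use in ∑S-≋.
      ∑S-≋ : ∀ p {h h′ : Image.S sec → Z.Carrier} → (∀ s → h s ≋ h′ s) → ∑S p h ≋ ∑S p h′
      ∑S-term-≋ : ∀ p {h h′ : Image.S sec → Z.Carrier} → (∀ s → h s ≋ h′ s) → ∀ e → _
      ∑S-≋ p h≋h′ = sum-rel (∑S-term-≋ p h≋h′)
      ∑S-term-≋ p h≋h′ e with inS? e | ≡-dec Fin._≟_ Fin._≟_ (inc e) p
      ... | yes e∈S | yes _ = h≋h′ (e , [ e∈S ])
      ... | yes _   | no  _ = 0-rel
      ... | no  _   | _     = 0-rel

      M-≋ : ∀ i j → M i j ≋ M j i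
      -- Inverting the exponents turns the sum over (i , j) into the second sum of `M j i` and the
      -- sum over (j , i) into the first, hence `≋-swap`.
      M-≋ i j = +-rel (D-≋ i j) (-‿rel (≋-swap
        (+-rel (∑S-≋ (i , j) (λ s → [1+T]^-≋ (α s) (Zₗ.- α s) (λ k → ℤ.+-inverseʳ (at (α s) k))))
               (∑S-≋ (j , i) (λ s → [1+T]^-≋ (Zₗ.- α s) (α s) (λ k → ℤ.+-inverseˡ (at (α s) k)))))))
        where
        module Zₗ = RawRing ℤₗ-rawRing
        ≋-swap : ∀ {f g h} → f ≋ g Z.+ h → f ≋ h Z.+ g
        ≋-swap {g = g} {h} (≋-intro p) =
          ≋-intro (~-resp-≈ ≈-refl (+-comm (reduction g) (reduction h)) p)

      -- f(T) = f((1+T)⁻¹ - 1), because the substitution transposes M.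
      f-≋ : f ≋ f
      f-≋ = ≋-intro (~-resp-≈ ≈-refl (begin
        reduction (det ℤₗ[[T]] (λ i j → M j i))  ≈⟨ reduction-det (λ i j → M j i) ⟩
        det rawRing (λ i j → reduction (M j i))  ≈⟨ det-transpose (λ i j → reduction (M i j)) ⟩
        det rawRing (λ i j → reduction (M i j))  ≈⟨ reduction-det M ⟨
        reduction f                              ∎) (reduction-~ (det-rel M-≋)))
        where
        open Determinant (truncated D) using (det-transpose)
        open SetoidReasoning setoid
        reduction-det : ∀ {n} (A : Fin n → Fin n → Z.Carrier) →
                        reduction (det ℤₗ[[T]] A) ≈ det rawRing (λ i j → reduction (A i j))
        reduction-det A = IsRingRelation.det-rel reduction-isRingRelation
          {A = A} {A′ = λ i j → reduction (A i j)} (λ i j → ≈-refl)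

-- Parity of the degree

even⇒pred-odd : ∀ {d} → (∃ λ k → d ≡ 2 ℕ.* k) → Odd (+ d ℤ.- 1ℤ)
even⇒pred-odd (k , ≡.refl) = + k ℤ.- 1ℤ , ≡.trans (≡.cong (ℤ._- 1ℤ) (ℤ.pos-* 2 k)) (double-pred (+ k))
  where
  double-pred : ∀ k → + 2 ℤ.* k ℤ.- 1ℤ ≡ + 2 ℤ.* (k ℤ.- 1ℤ) ℤ.+ 1ℤ
  double-pred = solve-∀

odd-prime∤2 : ∀ {ℓ} → Prime ℓ → Odd (+ ℓ) → ¬ ℓ ℕ.∣ 2
odd-prime∤2 ℓ-prime (k , ℓ≡2k+1) ℓ∣2 with prime⇒irreducible prime[2] ℓ∣2
... | inj₁ ≡.refl = ¬prime[1] ℓ-prime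
... | inj₂ ≡.refl = contradiction (ℕ.∣1⇒≡1 (ℤ.∣⇒∣ᵤ 2∣1)) λ ()
  where
  rearrange : ∀ k → (+ 2 ℤ.* k ℤ.+ 1ℤ) ℤ.- + 2 ℤ.* k ≡ 1ℤ
  rearrange = solve-∀
  2∣1 : + 2 ℤ.∣ 1ℤ
  2∣1 = ≡.subst (+ 2 ℤ.∣_) (≡.trans (≡.cong (ℤ._- + 2 ℤ.* k) ℓ≡2k+1) (rearrange k))
    (ℤ.∣m∣n⇒∣m-n ℤ.∣-refl (ℤ.∣m⇒∣m*n k ℤ.∣-refl))

module _ (ℓ : ℕ) (ℓ-prime : Prime ℓ) where
  open ℓ-adic ℓ ℓ-prime
  open Residues ℓ ℓ-prime

  -- The modulus ℓ^(μ+1) is the first for which ℓ^μ is nonzero, and truncation at d+1 is the first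
  -- that retains the coefficient of T^d.
  even-degree : ¬ ℓ ℕ.∣ 2 → ∀ {f} (W : WeierstrassFactorisation f) →
                let open WeierstrassFactorisation W in
                Reduction._≋_ (suc μ) (suc degree) f f → ∃ λ k → degree ≡ 2 ℕ.* k
  even-degree ℓ∤2 {f} W f≋f
    with Determinant.alternate-parity (ℤmod (suc (WeierstrassFactorisation.μ W))) (WeierstrassFactorisation.degree W)
  ... | inj₁ even       = even
  ... | inj₂ alternates = contradiction ℓ∣2 ℓ∤2
    where
    open WeierstrassFactorisation W
    open IsDistinguished g-distinguished
    N = suc μ
    open Reduction N (suc degree)
    open PowerSeries (ℤmod N) using (const; const-*; leading-*) renaming (_*_ to _*ˢ_)
    open CommutativeRing (ℤmod N) hiding (zero)
    open SetoidReasoning setoid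

    c : ℤ
    c = + (ℓ ^ μ)

    v : ℕ → ℤₗ
    v = proj₁ u-unit

    G U V : ℕ → ℤ
    G = reduction g
    U = reduction u
    V = reduction v

    module F = CommutativeRing (PowerSeries.truncated (ℤmod N) (suc degree))

    reduction-f : reduction f F.≈ (const c *ˢ G) *ˢ U
    reduction-f = F.trans (λ n _ → factorisation n N)
      (F.trans (reduction-* (RawRing._*_ ℤₗ[[T]] (scalar c) g) u)
        (F.*-congʳ {U} (F.trans (reduction-* (scalar c) g) (F.*-congʳ {G} (reduction-scalar c)))))

    cG-low : ∀ n → n ℕ.< degree → (const c *ˢ G) n ≈ 0ℤ
    cG-low n n<d with lower n n<d
    -- The factor ℓ from distinguishedness completes ℓ^μ to ℓ^(μ+1), which is zero here.
    ... | record { quotient = q ; equality = qℓ≈g } = begin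
      (const c *ˢ G) n           ≈⟨ const-* c G n ⟩
      c * G n                    ≈⟨ *-congˡ {c} (qℓ≈g N) ⟨
      c * (at q N * + ℓ)         ≈⟨ ≡ᵐ-reflexive (regroup c (at q N) (+ ℓ)) ⟩
      at q N * (+ ℓ * c)         ≈⟨ *-congˡ {at q N} (≡ᵐ-reflexive (≡.sym (ℤ.pos-* ℓ (ℓ ^ μ)))) ⟩
      at q N * + (ℓ ^ N)         ≈⟨ *-congˡ {at q N} ℓ^N≈0 ⟩
      at q N * 0ℤ                ≈⟨ zeroʳ (at q N) ⟩
      0ℤ                         ∎
      where
      ℓ^N≈0 : + (ℓ ^ N) ≈ 0ℤ
      ℓ^N≈0 = ≡-mod (≡.subst (+ (ℓ ^ N) ℤ.∣_) (≡.sym (ℤ.+-identityʳ _)) ℤ.∣-refl)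
      regroup : ∀ c q l → c ℤ.* (q ℤ.* l) ≡ q ℤ.* (l ℤ.* c)
      regroup = solve-∀

    product = leading-* degree (const c *ˢ G) U cG-low

    f-low : ∀ n → n ℕ.< degree → reduction f n ≈ 0ℤ
    f-low n n<d = trans (reduction-f n (ℕ.m≤n⇒m≤1+n n<d)) (proj₁ product n n<d)

    x : ℤ
    x = reduction f degree

    x≈cU : x ≈ c * U 0
    x≈cU = begin
      x                              ≈⟨ reduction-f degree (ℕ.n<1+n degree) ⟩
      ((const c *ˢ G) *ˢ U) degree   ≈⟨ proj₂ product ⟩
      (const c *ˢ G) degree * U 0    ≈⟨ *-congʳ {U 0} (const-* c G degree) ⟩
      c * G degree * U 0             ≈⟨ *-congʳ {U 0} (*-congˡ {c} (leading N)) ⟩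
      c * 1ℤ * U 0                   ≈⟨ *-congʳ {U 0} (*-identityʳ c) ⟩
      c * U 0                        ∎

    x≈-x : x ≈ - x
    x≈-x = trans (proj₂ (~-leading (reduction-~ f≋f) degree (ℕ.n<1+n degree) f-low)) (alternates x)

    UV≈1 : U 0 * V 0 ≈ 1ℤ
    -- The constant coefficient of `u * v` is a one-term sum, which ends in the empty sum 0.
    UV≈1 = trans (sym (+-identityʳ (U 0 * V 0))) (proj₂ u-unit 0 N)

    c*2≈0 : c * + 2 ≈ 0ℤ
    -- Multiplying 2x = 0 by the inverse `V 0` of the unit `U 0` leaves 2ℓ^μ; cancelling ℓ^μ from
    -- the resulting divisibility by ℓ^(μ+1) then gives ℓ ∣ 2.
    c*2≈0 = begin
      c * + 2                          ≈⟨ *-identityʳ (c * + 2) ⟨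
      c * + 2 * 1ℤ                     ≈⟨ *-congˡ {c * + 2} UV≈1 ⟨
      c * + 2 * (U 0 * V 0)            ≈⟨ ≡ᵐ-reflexive (regroup c (U 0) (V 0)) ⟩
      (c * U 0 + c * U 0) * V 0        ≈⟨ *-congʳ {V 0} (+-cong x≈cU x≈cU) ⟨
      (x + x) * V 0                    ≈⟨ *-congʳ {V 0} (+-congˡ {x} x≈-x) ⟩
      (x + - x) * V 0                  ≈⟨ *-congʳ {V 0} (-‿inverseʳ x) ⟩
      0ℤ * V 0                         ≈⟨ zeroˡ (V 0) ⟩
      0ℤ                               ∎
      where
      regroup : ∀ c u v → c ℤ.* + 2 ℤ.* (u ℤ.* v) ≡ (c ℤ.* u ℤ.+ c ℤ.* u) ℤ.* v
      regroup = solve-∀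

    ℓ∣2 : ℓ ℕ.∣ 2
    ℓ∣2 = ℕ.*-cancelˡ-∣ (ℓ ^ μ) {{ℓ^n≢0 μ}} (≡.subst₂ ℕ._∣_ (ℕ.*-comm ℓ (ℓ ^ μ)) (ℤ.abs-* c (+ 2))
      (ℤ.∣⇒∣ᵤ (≡.subst (+ (ℓ ^ N) ℤ.∣_) (ℤ.+-identityʳ (c * + 2)) (ℓ^n∣a-b c*2≈0))))

theorem2p18 : ∀ {u m : ℕ} (X : Multigraph (Fin u) (Fin m)) → χ X ≢ 0ℤ →
    ∀ (ℓ : ℕ) (ℓ-prime : Prime ℓ) → Odd (+ ℓ) →
    ∀ (sec : Multigraph.Section X) (α : Image.S sec → ℓ-adic.ℤₗ ℓ ℓ-prime) →
    let open ℓ-adic ℓ ℓ-prime in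
    let open Characteristic X sec α in
    (∀ (n : ℕ) → Multigraph.Connected (X/ n)) →
    ∀ (W : WeierstrassFactorisation f) → Odd (λ-invariant W)
theorem2p18 X _ ℓ ℓ-prime ℓ-odd sec α _ W = even⇒pred-odd
  (even-degree ℓ ℓ-prime (odd-prime∤2 ℓ-prime ℓ-odd) W (Residues.Reduction.f-≋ ℓ ℓ-prime _ _ X sec α))
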